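{- Let $C(n)$ be any one of the following fifteen integer sequences (defined for all integers $n\ge 0$; sums over $k$ or $l$ range over all integers for which the summand is nonzero): (a) $\sum_k \binom{n}{k}^3$; (b) $\sum_k \binom{n}{k}^2\binom{n+k}{n}$; (c) $\sum_k \binom{n}{k}^2\binom{2k}{k}$; (d) $\sum_k \binom{n}{k}\binom{2k}{k}\binom{2(n-k)}{n-k}$; (f) $\sum_{k=0}^{\lfloor n/3\rfloor} (-1)^k 3^{n-3k}\binom{n}{3k}\frac{(3k)!}{k!^3}$; (g) $\sum_{k,l} (-1)^k 8^{n-k}\binom{n}{k}\binom{k}{l}^3$; $(\delta)$ $\sum_{k=0}^{\lfloor n/3\rfloor} (-1)^k 3^{n-3k}\binom{n}{3k}\binom{n+k}{n}\frac{(3k)!}{k!^3}$; $(\eta)$ $\sum_{k=0}^{n} (-1)^k \binom{n}{k}^3\binom{4n-5k}{3n}$; $(\alpha)$ $\sum_k \binom{n}{k}^2\binom{2k}{k}\binom{2(n-k)}{n-k}$; $(\epsilon)$ $\sum_k \binom{n}{k}^2\binom{2k}{n}^2$; $(\zeta)$ $\sum_{k,l}\binom{n}{k}^2\binom{n}{l}\binom{k}{l}\binom{k+l}{n}$; $(\gamma)$ $\sum_k \binom{n}{k}^2\binom{n+k}{n}^2$; $(s_7)$ $\sum_k \binom{n}{k}^2\binom{n+k}{k}\binom{2k}{n}$; $(s_{10})$ $\sum_k \binom{n}{k}^4$; $(s_{18})$ $\sum_{k=0}^{n} (-1)^k \binom{n}{k}\binom{2k}{k}\binom{2(n-k)}{n-k}\binom{2n-3k}{n}$.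 Then $C(n)$ satisfies the Lucas congruences: for every prime $p$ and every integer $n\ge 0$ with base-$p$ expansion $n=n_0+n_1p+\cdots+n_rp^r$ ($0\le n_i<p$), we have $C(n)\equiv C(n_0)C(n_1)\cdots C(n_r)\pmod p$.
   Context: Binomial coefficients with possibly negative upper entry are defined, for integers $m\ge0$ and any number $x$, by $\binom{x}{m}=\frac{x(x-1)\cdots(x-m+1)}{m!}$, and $\binom{x}{m}=0$ for negative integers $m$. (With this convention the sums for $(\eta)$ and $s_{18}$ agree with the forms $\sum_{k=0}^{\lfloor n/5\rfloor}(-1)^k\binom{n}{k}^3\bigl(\binom{4n-5k-1}{3n}+\binom{4n-5k}{3n}\bigr)$ and $\sum_{k=0}^{\lfloor n/3\rfloor}(-1)^k\binom{n}{k}\binom{2k}{k}\binom{2(n-k)}{n-k}\bigl[\binom{2n-3k-1}{n}+\binom{2n-3k}{n}\bigr]$ for $n\ge1$, and both sequences equal $1$ at $n=0$.) These are the sporadic Apéry-like sequences. -}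

module Defs where

open import Data.Nat as ℕ using (ℕ; zero; suc; _∸_; _!)
open import Data.Nat.Combinatorics using (_C_)
open import Data.Nat.Properties using (_!≢0; m^n≢0)
open import Data.Integer as ℤ using (ℤ; +_; _+_; _-_; _*_; _^_; -1ℤ; 0ℤ; 1ℤ; _/ℕ_)
open import Data.List using (List; []; _∷_)

sumTo : ℕ → (ℕ → ℤ) → ℤ
sumTo zero    f = f 0
sumTo (suc n) f = sumTo n f + f (suc n)

bin : ℕ → ℕ → ℤ
bin n k = + (n C k)

falling : ℤ → ℕ → ℤ
falling x zero    = 1ℤ
falling x (suc m) = falling x m * (x - + m)

-- binomial coefficient with integer upper entry, as in the paper:
--   binom x m = x (x-1) ... (x-m+1) / m!   (m ≥ 0; the division is exact)
binomℤ : ℤ → ℕ → ℤ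
binomℤ x m = (falling x m /ℕ (m !)) {{m !≢0}}

-- (3k)! / k!^3  (exact division in ℕ)
multi3 : ℕ → ℕ
multi3 k = ((3 ℕ.* k) ! ℕ./ ((k !) ℕ.^ 3)) {{m^n≢0 (k !) 3 {{k !≢0}}}}

sgn : ℕ → ℤ
sgn k = -1ℤ ^ k

data Seq : Set where
  a b c d f g δ η α ε ζ γ s7 s10 s18 : Seq

Cseq : Seq → ℕ → ℤ
Cseq a n = sumTo n λ k → bin n k ^ 3
Cseq b n = sumTo n λ k → bin n k ^ 2 * bin (n ℕ.+ k) n
Cseq c n = sumTo n λ k → bin n k ^ 2 * bin (2 ℕ.* k) k
Cseq d n = sumTo n λ k → bin n k * bin (2 ℕ.* k) k * bin (2 ℕ.* (n ∸ k)) (n ∸ k)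
Cseq f n = sumTo (n ℕ./ 3) λ k →
          sgn k * + (3 ℕ.^ (n ∸ 3 ℕ.* k)) * bin n (3 ℕ.* k) * + multi3 k
Cseq g n = sumTo n λ k → sumTo k λ l →
          sgn k * + (8 ℕ.^ (n ∸ k)) * bin n k * bin k l ^ 3
Cseq δ n = sumTo (n ℕ./ 3) λ k →
          sgn k * + (3 ℕ.^ (n ∸ 3 ℕ.* k)) * bin n (3 ℕ.* k) * bin (n ℕ.+ k) n * + multi3 k
-- (η)  Σ_{k=0}^{n} (-1)^k C(n,k)^3 C(4n-5k,3n)   (upper entry may be negative)
Cseq η n = sumTo n λ k →
          sgn k * bin n k ^ 3 * binomℤ (+ (4 ℕ.* n) - + (5 ℕ.* k)) (3 ℕ.* n)
Cseq α n = sumTo n λ k → bin n k ^ 2 * bin (2 ℕ.* k) k * bin (2 ℕ.* (n ∸ k)) (n ∸ k)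
Cseq ε n = sumTo n λ k → bin n k ^ 2 * bin (2 ℕ.* k) n ^ 2
Cseq ζ n = sumTo n λ k → sumTo n λ l →
          bin n k ^ 2 * bin n l * bin k l * bin (k ℕ.+ l) n
Cseq γ n = sumTo n λ k → bin n k ^ 2 * bin (n ℕ.+ k) n ^ 2
Cseq s7 n = sumTo n λ k → bin n k ^ 2 * bin (n ℕ.+ k) k * bin (2 ℕ.* k) n
Cseq s10 n = sumTo n λ k → bin n k ^ 4
-- (s18) Σ_{k=0}^{n} (-1)^k C(n,k) C(2k,k) C(2(n-k),n-k) C(2n-3k,n)  (upper entry may be negative)
Cseq s18 n = sumTo n λ k →
          sgn k * bin n k * bin (2 ℕ.* k) k * bin (2 ℕ.* (n ∸ k)) (n ∸ k)
            * binomℤ (+ (2 ℕ.* n) - + (3 ℕ.* k)) n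

fromDigits : ℕ → List ℕ → ℕ
fromDigits p []       = 0
fromDigits p (x ∷ xs) = x ℕ.+ p ℕ.* fromDigits p xs

prodC : Seq → List ℕ → ℤ
prodC s []       = 1ℤ
prodC s (x ∷ xs) = Cseq s x * prodC s xs

{-# OPTIONS --safe #-}
module Submission where

-- Write n = n₀ + p n′ and k = k₀ + p k′ with n₀, k₀ < p.  For thirteen of the sequences the k-th
-- summand F(n,k) satisfies F(n,k) ≡ F(n₀,k₀) F(n′,k′): Lucas' theorem applies to each binomial
-- coefficient, and whenever a carry occurs both sides vanish.  Summing over k gives the claim.
--
-- (η) and (s₁₈) have the form S(n) = Σ w(n,k) C((c+1)n-(c+2)k, cn) with c = 3, 1 and w(n,k) as above.
-- Put U(j,i) = Σ w(n,k) C((c+1)n-(c+2)k+j, cn+i).  If cn₀ = r + pi and (c+1)n₀-(c+2)k₀ = x₀ + pe, the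
-- inner sum over k′ is C(x₀,r) U(e,i)(n′).  The reflection k ↦ n-k gives U(j,i) = (-1)^i U(i-1-j,i),
-- Pascal's rule gives U(j+1,i+1) = U(j,i) + U(j,i+1), and together they show U(e,i) = C(e,i) S plus,
-- only for i = 2, an error U(0,2) independent of e.  The total coefficient of that error is
-- Σ_k (-1)^k C(n₀,k)³ C(4n₀-5k, 3n₀-2p), which vanishes mod p because (-1)^k C(n₀,k) is a polynomial in k
-- of degree p-1-n₀ for 0 ≤ k < p, so that the summand has degree p-3.

open import Defs using (sumTo; bin; falling; binomℤ; multi3; sgn)
open import Data.Nat as ℕ using (ℕ; zero; suc; _∸_; _!; _<_; _≤_; z≤n; s≤s; NonZero)
open import Data.Nat.Combinatorics using (_C_; nCk+nC[k+1]≡[n+1]C[k+1]; nCn≡1; nCk≡n!/k![n-k]!; k![n∸k]!∣n!; k>n⇒nCk≡0; nCk≡nC[n∸k])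
import Data.Nat.Divisibility as ℕ
import Data.Nat.DivMod as ℕ
open import Data.Nat.Primality using (Prime; euclidsLemma; prime⇒nonZero)
import Data.Nat.Properties as ℕ
import Data.Nat.Tactic.RingSolver as ℕ-Ring
open import Data.Integer using (ℤ; +_; -[1+_]; _+_; _-_; _*_; _^_; -_; ∣_∣; 0ℤ; 1ℤ; -1ℤ; _/ℕ_; _%ℕ_)
import Data.Integer.Divisibility as Unsigned
open import Data.Integer.Divisibility.Signed using (_∣_; divides; ∣-refl; ∣m∣n⇒∣m+n; ∣m⇒∣-m; ∣n⇒∣m*n; ∣m⇒∣m*n; ∣⇒∣ᵤ; ∣ᵤ⇒∣)
open import Data.Integer.DivMod using (a≡a%ℕn+[a/ℕn]*n; n%ℕd<d)
import Data.Integer.Properties as ℤ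
open import Data.Integer.Tactic.RingSolver using (solve-∀)
open import Data.List using (List; []; _∷_)
open import Data.List.Relation.Unary.All using (All; []; _∷_)
open import Data.Product using (∃; _,_; _×_)
open import Data.Sum using (_⊎_; inj₁; inj₂)
open import Relation.Binary using (Setoid)
open import Relation.Binary.PropositionalEquality
open import Relation.Nullary using (yes; no; contradiction)

-- Binomial coefficients with integer upper entry

-- For a negative upper entry this is the identity C(-1-n, k) = (-1)^k C(n+k, k). No division
-- occurs, so Pascal's rule and induction apply directly; `binomℤ≡B` links it to the quotient of a
-- falling factorial.
B : ℤ → ℕ → ℤ
B (+ n)    k = bin n k
B -[1+ n ] k = sgn k * bin (n ℕ.+ k) k

bin-zero : ∀ {n k} → n < k → bin n k ≡ 0ℤ
bin-zero n<k = cong +_ (k>n⇒nCk≡0 n<k)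

bin-full : ∀ n → bin n n ≡ 1ℤ
bin-full n = cong +_ (nCn≡1 n)

bin-pascal : ∀ n k → bin (suc n) (suc k) ≡ bin n k + bin n (suc k)
bin-pascal n k = trans (cong +_ (sym (nCk+nC[k+1]≡[n+1]C[k+1] n k))) (ℤ.pos-+ (n C k) _)

B-pascal : ∀ x k → B (1ℤ + x) (suc k) ≡ B x k + B x (suc k)
B-pascal (+ n) k = bin-pascal n k
B-pascal -[1+ zero ] k = sym (trans (cong₂ (λ u v → sgn k * u + -1ℤ * sgn k * v) (bin-full k) (bin-full (suc k))) (lem (sgn k)))
  where
  lem : ∀ s → s * 1ℤ + -1ℤ * s * 1ℤ ≡ 0ℤ
  lem = solve-∀
B-pascal -[1+ suc n ] k =
  trans (lem (sgn k) (bin (n ℕ.+ suc k) k) _)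
        (cong₂ (λ u v → sgn k * u + -1ℤ * sgn k * v) (cong (λ m → bin m k) (ℕ.+-suc n k)) (sym (bin-pascal (n ℕ.+ suc k) k)))
  where
  lem : ∀ s u v → -1ℤ * s * v ≡ s * u + -1ℤ * s * (u + v)
  lem = solve-∀

B-0 : ∀ x → B x 0 ≡ 1ℤ
B-0 (+ n)    = refl
B-0 -[1+ n ] = refl

-- The usual companion of an invertible recurrence: Pascal's rule can be run upwards and downwards
-- from the upper entry 0.
ℤ-induction : (P : ℤ → Set) → P 0ℤ → (∀ x → P x → P (1ℤ + x)) → (∀ x → P (1ℤ + x) → P x) → ∀ x → P x
ℤ-induction P p0 up down (+ zero)      = p0
ℤ-induction P p0 up down (+ suc n)     = up (+ n) (ℤ-induction P p0 up down (+ n))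
ℤ-induction P p0 up down -[1+ zero ]   = down -[1+ zero ] p0
ℤ-induction P p0 up down -[1+ suc n ]  = down -[1+ suc n ] (ℤ-induction P p0 up down -[1+ n ])

-- Integer induction on `x`, with Pascal's rule as the step in both directions. It identifies `B`
-- with falling factorials and later allows division by `suc k` modulo p.
B-absorb : ∀ x k → + suc k * B x (suc k) ≡ B x k * (x - + k)
B-absorb = ℤ-induction (λ x → ∀ k → + suc k * B x (suc k) ≡ B x k * (x - + k)) base up down
  where
  base : ∀ k → + suc k * 0ℤ ≡ B 0ℤ k * (0ℤ - + k)
  base zero    = refl
  base (suc k) = ℤ.*-zeroʳ (+ suc (suc k))

  up : ∀ x → (∀ k → + suc k * B x (suc k) ≡ B x k * (x - + k)) →
       ∀ k → + suc k * B (1ℤ + x) (suc k) ≡ B (1ℤ + x) k * (1ℤ + x - + k)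
  up x ih zero rewrite B-pascal x 0 | B-0 x | B-0 (1ℤ + x) =
    trans (lem (B x 1)) (trans (cong (_+_ 1ℤ) (trans (ih 0) (cong (_* (x - 0ℤ)) (B-0 x)))) (lem′ x))
    where
    lem : ∀ y → 1ℤ * (1ℤ + y) ≡ 1ℤ + 1ℤ * y
    lem = solve-∀
    lem′ : ∀ x → 1ℤ + 1ℤ * (x - 0ℤ) ≡ 1ℤ * (1ℤ + x - 0ℤ)
    lem′ = solve-∀
  up x ih (suc j) rewrite B-pascal x (suc j) | B-pascal x j = begin
    (1ℤ + (1ℤ + k)) * (v + w)            ≡⟨ lem₁ k v w ⟩
    (1ℤ + (1ℤ + k)) * v + (1ℤ + (1ℤ + k)) * w ≡⟨ cong (_+_ ((1ℤ + (1ℤ + k)) * v)) (ih (suc j)) ⟩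
    (1ℤ + (1ℤ + k)) * v + v * (x - (1ℤ + k))   ≡⟨ lem₂ k v x ⟩
    (1ℤ + k) * v + v * (x - k) ≡⟨ cong (_+ v * (x - k)) (ih j) ⟩
    u * (x - k) + v * (x - k) ≡⟨ lem₃ k u v x ⟩
    (u + v) * (1ℤ + x - (1ℤ + k)) ∎
    where
    open ≡-Reasoning
    k = + j
    u = B x j
    v = B x (suc j)
    w = B x (suc (suc j))
    lem₁ : ∀ k v w → (1ℤ + (1ℤ + k)) * (v + w) ≡ (1ℤ + (1ℤ + k)) * v + (1ℤ + (1ℤ + k)) * w
    lem₁ = solve-∀
    lem₂ : ∀ k v x → (1ℤ + (1ℤ + k)) * v + v * (x - (1ℤ + k)) ≡ (1ℤ + k) * v + v * (x - k)
    lem₂ = solve-∀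
    lem₃ : ∀ k u v x → u * (x - k) + v * (x - k) ≡ (u + v) * (1ℤ + x - (1ℤ + k))
    lem₃ = solve-∀

  down : ∀ x → (∀ k → + suc k * B (1ℤ + x) (suc k) ≡ B (1ℤ + x) k * (1ℤ + x - + k)) →
         ∀ k → + suc k * B x (suc k) ≡ B x k * (x - + k)
  -- Pascal's rule writes `B x (suc k)` as a difference. What remains in `step` is absorption at the
  -- previous index, obtained by calling `down` recursively.
  down x ih k = trans (trans (lem₁ (+ suc k) (B x k) (B x (suc k)))
                     (cong (_- (+ suc k * B x k)) (trans (cong (+ suc k *_) (sym (B-pascal x k))) (ih k)))) (step k)
    where
    lem₁ : ∀ k u v → k * v ≡ k * (u + v) - k * u
    lem₁ = solve-∀
    lem₀ : ∀ x → 1ℤ * (1ℤ + x - 0ℤ) - (1ℤ + 0ℤ) * 1ℤ ≡ 1ℤ * (x - 0ℤ)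
    lem₀ = solve-∀
    lem₂ : ∀ x k u v → (u + v) * (1ℤ + x - (1ℤ + k)) - (1ℤ + (1ℤ + k)) * v ≡ u * (x - k) + v * (x - k) - (1ℤ + (1ℤ + k)) * v
    lem₂ = solve-∀
    lem₃ : ∀ x k v → (1ℤ + k) * v + v * (x - k) - (1ℤ + (1ℤ + k)) * v ≡ v * (x - (1ℤ + k))
    lem₃ = solve-∀
    step : ∀ k → B (1ℤ + x) k * (1ℤ + x - + k) - + suc k * B x k ≡ B x k * (x - + k)
    step zero rewrite B-0 x | B-0 (1ℤ + x) = lem₀ x
    step (suc j) rewrite B-pascal x j =
      trans (lem₂ x (+ j) (B x j) (B x (suc j)))
      (trans (cong (λ t → t + B x (suc j) * (x - + j) - + suc (suc j) * B x (suc j)) (sym (down x ih j)))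
             (lem₃ x (+ j) (B x (suc j))))

falling≡!*B : ∀ x m → falling x m ≡ + (m !) * B x m
falling≡!*B x zero    = sym (cong (1ℤ *_) (B-0 x))
falling≡!*B x (suc m) = begin
  falling x m * (x - + m)           ≡⟨ cong (_* (x - + m)) (falling≡!*B x m) ⟩
  + (m !) * B x m * (x - + m)       ≡⟨ ℤ.*-assoc (+ (m !)) (B x m) _ ⟩
  + (m !) * (B x m * (x - + m))     ≡⟨ cong (+ (m !) *_) (B-absorb x m) ⟨
  + (m !) * (+ suc m * B x (suc m)) ≡⟨ lem (+ (m !)) (+ suc m) (B x (suc m)) ⟩
  + suc m * + (m !) * B x (suc m)   ≡⟨ cong (_* B x (suc m)) (ℤ.pos-* (suc m) (m !)) ⟨
  + (suc m !) * B x (suc m)         ∎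
  where
  open ≡-Reasoning
  lem : ∀ u v w → u * (v * w) ≡ v * u * w
  lem = solve-∀

-- The remainder equals `∣ x - q ∣ * d` and is smaller than `d`, so `x - q` must be zero.
*-/ℕ-cancelˡ : ∀ d .{{_ : NonZero d}} x → (+ d * x) /ℕ d ≡ x
*-/ℕ-cancelˡ d x = sym (ℤ.i-j≡0⇒i≡j x q (ℤ.∣i∣≡0⇒i≡0 (small ∣ x - q ∣ (subst (_< d) r≡ (n%ℕd<d (+ d * x) d)))))
  where
  q = (+ d * x) /ℕ d
  r = (+ d * x) %ℕ d
  lem : ∀ d x q r → d * x ≡ r + q * d → r ≡ (x - q) * d
  lem d x q r eq = trans (solve₁ d q r) (trans (cong (_- q * d) (sym eq)) (solve₂ d x q))
    where
    solve₁ : ∀ d q r → r ≡ r + q * d - q * d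
    solve₁ = solve-∀
    solve₂ : ∀ d x q → d * x - q * d ≡ (x - q) * d
    solve₂ = solve-∀
  r≡ : r ≡ ∣ x - q ∣ ℕ.* d
  r≡ = trans (cong ∣_∣ (lem (+ d) x q (+ r) (a≡a%ℕn+[a/ℕn]*n (+ d * x) d))) (ℤ.abs-* (x - q) (+ d))
  small : ∀ m → m ℕ.* d < d → m ≡ 0
  small zero    _  = refl
  small (suc m) lt = contradiction lt (ℕ.≤⇒≯ (ℕ.m≤m+n d (m ℕ.* d)))

binomℤ≡B : ∀ x m → binomℤ x m ≡ B x m
binomℤ≡B x m = trans (cong (λ y → (y /ℕ (m !)) {{m ℕ.!≢0}}) (falling≡!*B x m)) (*-/ℕ-cancelˡ (m !) {{m ℕ.!≢0}} (B x m))

sgn² : ∀ k → sgn k * sgn k ≡ 1ℤ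
sgn² zero    = refl
sgn² (suc k) = trans (lem (sgn k)) (sgn² k)
  where
  lem : ∀ s → -1ℤ * s * (-1ℤ * s) ≡ s * s
  lem = solve-∀

-- For negative `x` this is the definition of `B`. For 0 ≤ x < k both entries lie in the range where
-- the coefficient is zero. For x ≥ k the reflected entry is negative and the two signs cancel.
B-reflect : ∀ x k → B x k ≡ sgn k * B (+ k - 1ℤ - x) k
B-reflect -[1+ n ] k = cong (λ y → sgn k * B y k) (trans (ℤ.pos-+ n k) (lem (+ n) (+ k)))
  where
  lem : ∀ n k → n + k ≡ k - 1ℤ - (- (1ℤ + n))
  lem = solve-∀
B-reflect (+ n) k with ℕ.<-≤-connex n k
... | inj₁ n<k = trans (bin-zero n<k) (sym (trans (cong (sgn k *_) (trans (cong (λ y → B y k) eq) (bin-zero (ℕ.∸-monoʳ-< {k} {suc n} {0} (s≤s z≤n) n<k)))) (ℤ.*-zeroʳ (sgn k))))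
  where
  lem : ∀ n k → k - 1ℤ - n ≡ k - (1ℤ + n)
  lem = solve-∀
  eq : + k - 1ℤ - + n ≡ + (k ∸ suc n)
  eq = trans (lem (+ n) (+ k)) (trans (ℤ.m-n≡m⊖n k (suc n)) (ℤ.⊖-≥ n<k))
... | inj₂ k≤n = sym (trans (cong (λ y → sgn k * B y k) eq) (trans (sym (ℤ.*-assoc (sgn k) _ _)) (trans (cong₂ _*_ (sgn² k) (cong (λ m → bin m k) (ℕ.m∸n+n≡m k≤n))) (ℤ.*-identityˡ _))))
  where
  lem : ∀ j k → k - 1ℤ - (j + k) ≡ - (1ℤ + j)
  lem = solve-∀
  eq : + k - 1ℤ - + n ≡ -[1+ n ∸ k ]
  eq = trans (cong (λ m → + k - 1ℤ - m) (trans (cong +_ (sym (ℕ.m∸n+n≡m k≤n))) (ℤ.pos-+ (n ∸ k) k))) (lem (+ (n ∸ k)) (+ k))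

B-absorb-upper : ∀ x k → + suc k * B (1ℤ + x) (suc k) ≡ (1ℤ + x) * B x k
B-absorb-upper x k = begin
  + suc k * B (1ℤ + x) (suc k)              ≡⟨ cong (_*_ (+ suc k)) (B-pascal x k) ⟩
  + suc k * (B x k + B x (suc k))           ≡⟨ ℤ.*-distribˡ-+ (+ suc k) (B x k) _ ⟩
  + suc k * B x k + + suc k * B x (suc k)   ≡⟨ cong (_+_ (+ suc k * B x k)) (B-absorb x k) ⟩
  (1ℤ + + k) * B x k + B x k * (x - + k)    ≡⟨ lem (+ k) (B x k) x ⟩
  (1ℤ + x) * B x k                          ∎
  where
  open ≡-Reasoning
  lem : ∀ k u x → (1ℤ + k) * u + u * (x - k) ≡ (1ℤ + x) * u
  lem = solve-∀

sgn-∸ : ∀ {n k} → k ≤ n → sgn (n ∸ k) ≡ sgn n * sgn k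
sgn-∸ {n} {k} k≤n = begin
  sgn (n ∸ k)                    ≡⟨ ℤ.*-identityʳ _ ⟨
  sgn (n ∸ k) * 1ℤ               ≡⟨ cong (sgn (n ∸ k) *_) (sgn² k) ⟨
  sgn (n ∸ k) * (sgn k * sgn k)  ≡⟨ ℤ.*-assoc (sgn (n ∸ k)) (sgn k) (sgn k) ⟨
  sgn (n ∸ k) * sgn k * sgn k    ≡⟨ cong (_* sgn k) (ℤ.^-distribˡ-+-* -1ℤ (n ∸ k) k) ⟨
  sgn (n ∸ k ℕ.+ k) * sgn k      ≡⟨ cong (λ m → sgn m * sgn k) (ℕ.m∸n+n≡m k≤n) ⟩
  sgn n * sgn k                  ∎
  where open ≡-Reasoning

bin-∸ : ∀ {n k} → k ≤ n → bin n (n ∸ k) ≡ bin n k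
bin-∸ k≤n = cong +_ (sym (nCk≡nC[n∸k] k≤n))

-- Factorials and the multinomial coefficient n!/(k!³(n-3k)!)

C*!*!≡! : ∀ {n k} → k ≤ n → (n C k) ℕ.* (k ! ℕ.* (n ∸ k) !) ≡ n !
C*!*!≡! {n} {k} k≤n = trans (cong (ℕ._* (k ! ℕ.* (n ∸ k) !)) (nCk≡n!/k![n-k]! k≤n)) (ℕ.m/n*n≡m {{k ℕ.!* (n ∸ k) !≢0}} (k![n∸k]!∣n! k≤n))

[k+j]Ck*k!*j! : ∀ k j → ((k ℕ.+ j) C k) ℕ.* (k ! ℕ.* j !) ≡ (k ℕ.+ j) !
[k+j]Ck*k!*j! k j = subst (λ i → ((k ℕ.+ j) C k) ℕ.* (k ! ℕ.* i !) ≡ (k ℕ.+ j) !) (ℕ.m+n∸m≡n k j) (C*!*!≡! (ℕ.m≤m+n k j))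

-- For 3k ≤ n this is n!/(k!³(n-3k)!), written with `k` as every lower entry so that base-p digits
-- of `k` can be used without multiplying them by 3.
trinomial : ℕ → ℕ → ℕ
trinomial n k = (n C k) ℕ.* ((n ∸ k) C k) ℕ.* ((n ∸ k ∸ k) C k)

-- Writing the upper entry as k + (k + (k + j)) removes the truncated subtractions; the three
-- factorial formulas then telescope.
trinomial-! : ∀ k j → trinomial (k ℕ.+ (k ℕ.+ (k ℕ.+ j))) k ℕ.* ((k !) ℕ.^ 3 ℕ.* j !) ≡ (k ℕ.+ (k ℕ.+ (k ℕ.+ j))) !
trinomial-! k j = trans (cong (ℕ._* ((k !) ℕ.^ 3 ℕ.* j !)) (cong₂ (λ x y → (N C k) ℕ.* (x C k) ℕ.* (y C k)) e₁ e₂))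
    (trans (lem (N C k) (M C k) ((k ℕ.+ j) C k) (k !) (j !))
    (trans (cong (λ t → (N C k) ℕ.* (k ! ℕ.* ((M C k) ℕ.* (k ! ℕ.* t)))) ([k+j]Ck*k!*j! k j))
    (trans (cong (λ t → (N C k) ℕ.* (k ! ℕ.* t)) ([k+j]Ck*k!*j! k (k ℕ.+ j)))
           ([k+j]Ck*k!*j! k M))))
  where
  M = k ℕ.+ (k ℕ.+ j)
  N = k ℕ.+ M
  e₁ : N ∸ k ≡ M
  e₁ = ℕ.m+n∸m≡n k M
  e₂ : N ∸ k ∸ k ≡ k ℕ.+ j
  e₂ = trans (cong (_∸ k) e₁) (ℕ.m+n∸m≡n k (k ℕ.+ j))
  lem : ∀ x y z f g → x ℕ.* y ℕ.* z ℕ.* (f ℕ.* (f ℕ.* (f ℕ.* 1)) ℕ.* g) ≡ x ℕ.* (f ℕ.* (y ℕ.* (f ℕ.* (z ℕ.* (f ℕ.* g)))))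
  lem = ℕ-Ring.solve-∀

multi3*k!³ : ∀ k → multi3 k ℕ.* (k !) ℕ.^ 3 ≡ (3 ℕ.* k) !
-- `3 * k` unfolds to `k + (k + (k + 0))`, so the case j = 0 of `trinomial-!` exhibits the cofactor
-- that makes the division exact.
multi3*k!³ k = ℕ.m/n*n≡m {{ℕ.m^n≢0 (k !) 3 {{k ℕ.!≢0}}}} (ℕ.divides (trinomial (3 ℕ.* k) k)
  (sym (trans (cong (trinomial (3 ℕ.* k) k ℕ.*_) (sym (ℕ.*-identityʳ ((k !) ℕ.^ 3)))) (trinomial-! k 0))))

C*multi3≡trinomial : ∀ {n k} → 3 ℕ.* k ≤ n → (n C (3 ℕ.* k)) ℕ.* multi3 k ≡ trinomial n k
C*multi3≡trinomial {n} {k} 3k≤n = ℕ.*-cancelʳ-≡ _ _ ((k !) ℕ.^ 3 ℕ.* j !)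
    {{ℕ.m*n≢0 ((k !) ℕ.^ 3) (j !) {{ℕ.m^n≢0 (k !) 3 {{k ℕ.!≢0}}}} {{j ℕ.!≢0}}}}
    (begin
      (n C (3 ℕ.* k)) ℕ.* multi3 k ℕ.* ((k !) ℕ.^ 3 ℕ.* j !)   ≡⟨ lem (n C (3 ℕ.* k)) (multi3 k) ((k !) ℕ.^ 3) (j !) ⟩
      (n C (3 ℕ.* k)) ℕ.* (multi3 k ℕ.* (k !) ℕ.^ 3 ℕ.* j !)   ≡⟨ cong (λ t → (n C (3 ℕ.* k)) ℕ.* (t ℕ.* j !)) (multi3*k!³ k) ⟩
      (n C (3 ℕ.* k)) ℕ.* ((3 ℕ.* k) ! ℕ.* j !)                ≡⟨ C*!*!≡! 3k≤n ⟩
      n !                                                      ≡⟨ cong _! n≡ ⟩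
      (k ℕ.+ (k ℕ.+ (k ℕ.+ j))) !                              ≡⟨ trinomial-! k j ⟨
      trinomial (k ℕ.+ (k ℕ.+ (k ℕ.+ j))) k ℕ.* ((k !) ℕ.^ 3 ℕ.* j !) ≡⟨ cong (λ m → trinomial m k ℕ.* ((k !) ℕ.^ 3 ℕ.* j !)) n≡ ⟨
      trinomial n k ℕ.* ((k !) ℕ.^ 3 ℕ.* j !)                  ∎)
  where
  open ≡-Reasoning
  j = n ∸ 3 ℕ.* k
  lem : ∀ x y z w → x ℕ.* y ℕ.* (z ℕ.* w) ≡ x ℕ.* (y ℕ.* z ℕ.* w)
  lem = ℕ-Ring.solve-∀
  assoc : ∀ k j → 3 ℕ.* k ℕ.+ j ≡ k ℕ.+ (k ℕ.+ (k ℕ.+ j))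
  assoc = ℕ-Ring.solve-∀
  n≡ : n ≡ k ℕ.+ (k ℕ.+ (k ℕ.+ j))
  n≡ = trans (sym (ℕ.m+[n∸m]≡n 3k≤n)) (assoc k j)

-- Finite sums and differences

-- The exclusive bound admits the empty sum and lets a range of length p·n split into n blocks of
-- length p.
sumlt : ℕ → (ℕ → ℤ) → ℤ
sumlt zero    f = 0ℤ
sumlt (suc n) f = sumlt n f + f n

sumTo≡sumlt : ∀ n f → sumTo n f ≡ sumlt (suc n) f
sumTo≡sumlt zero    f = sym (ℤ.+-identityˡ (f 0))
sumTo≡sumlt (suc n) f = cong (_+ f (suc n)) (sumTo≡sumlt n f)

sumlt-cong : ∀ n {f g} → (∀ k → k < n → f k ≡ g k) → sumlt n f ≡ sumlt n g
sumlt-cong zero    eq = refl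
sumlt-cong (suc n) eq = cong₂ _+_ (sumlt-cong n (λ k k<n → eq k (ℕ.m<n⇒m<1+n k<n))) (eq n ℕ.≤-refl)

sumlt-+ : ∀ n f g → sumlt n (λ k → f k + g k) ≡ sumlt n f + sumlt n g
sumlt-+ zero    f g = refl
sumlt-+ (suc n) f g = trans (cong (_+ (f n + g n)) (sumlt-+ n f g)) (lem (sumlt n f) (sumlt n g) (f n) (g n))
  where
  lem : ∀ s t u v → s + t + (u + v) ≡ s + u + (t + v)
  lem = solve-∀

sumlt-*ˡ : ∀ n x f → sumlt n (λ k → x * f k) ≡ x * sumlt n f
sumlt-*ˡ zero    x f = sym (ℤ.*-zeroʳ x)
sumlt-*ˡ (suc n) x f = trans (cong (_+ x * f n) (sumlt-*ˡ n x f)) (sym (ℤ.*-distribˡ-+ x (sumlt n f) (f n)))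

sumlt-*ʳ : ∀ n x f → sumlt n (λ k → f k * x) ≡ sumlt n f * x
sumlt-*ʳ zero    x f = refl
sumlt-*ʳ (suc n) x f = trans (cong (_+ f n * x) (sumlt-*ʳ n x f)) (sym (ℤ.*-distribʳ-+ x (sumlt n f) (f n)))

sumlt-0 : ∀ n → sumlt n (λ _ → 0ℤ) ≡ 0ℤ
sumlt-0 zero    = refl
sumlt-0 (suc n) = trans (ℤ.+-identityʳ _) (sumlt-0 n)

sumlt-swap : ∀ m n (f : ℕ → ℕ → ℤ) → sumlt m (λ i → sumlt n (f i)) ≡ sumlt n (λ j → sumlt m (λ i → f i j))
sumlt-swap zero    n f = sym (sumlt-0 n)
sumlt-swap (suc m) n f = trans (cong (_+ sumlt n (f m)) (sumlt-swap m n f)) (sym (sumlt-+ n (λ j → sumlt m (λ i → f i j)) (f m)))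

sumlt-split : ∀ m n f → sumlt (m ℕ.+ n) f ≡ sumlt m f + sumlt n (λ k → f (m ℕ.+ k))
sumlt-split m zero    f rewrite ℕ.+-identityʳ m = sym (ℤ.+-identityʳ _)
sumlt-split m (suc n) f rewrite ℕ.+-suc m n =
  trans (cong (_+ f (m ℕ.+ n)) (sumlt-split m n f)) (ℤ.+-assoc (sumlt m f) _ _)

sumlt-blocks : ∀ p n f → sumlt (p ℕ.* n) f ≡ sumlt n (λ j → sumlt p (λ i → f (i ℕ.+ p ℕ.* j)))
sumlt-blocks p zero    f rewrite ℕ.*-zeroʳ p = refl
sumlt-blocks p (suc n) f rewrite ℕ.*-suc p n | ℕ.+-comm p (p ℕ.* n) =
  trans (sumlt-split (p ℕ.* n) p f)
        (cong₂ _+_ (sumlt-blocks p n f) (sumlt-cong p (λ i _ → cong f (ℕ.+-comm (p ℕ.* n) i))))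

sumlt-extend : ∀ {m n} f → m ≤ n → (∀ k → m ≤ k → f k ≡ 0ℤ) → sumlt n f ≡ sumlt m f
sumlt-extend {m} {n} f m≤n vanish = begin
  sumlt n f                                       ≡⟨ cong (λ i → sumlt i f) (ℕ.m+[n∸m]≡n m≤n) ⟨
  sumlt (m ℕ.+ (n ∸ m)) f                         ≡⟨ sumlt-split m (n ∸ m) f ⟩
  sumlt m f + sumlt (n ∸ m) (λ k → f (m ℕ.+ k))   ≡⟨ cong (_+_ (sumlt m f)) (trans (sumlt-cong (n ∸ m) (λ k _ → vanish (m ℕ.+ k) (ℕ.m≤m+n m k))) (sumlt-0 (n ∸ m))) ⟩
  sumlt m f + 0ℤ                                  ≡⟨ ℤ.+-identityʳ _ ⟩
  sumlt m f                                       ∎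
  where open ≡-Reasoning

sumlt-head : ∀ n f → sumlt (suc n) f ≡ f 0 + sumlt n (λ k → f (suc k))
sumlt-head n f = trans (sumlt-split 1 n f) (cong (_+ sumlt n (λ k → f (suc k))) (ℤ.+-identityˡ (f 0)))

sumlt-reverse : ∀ n f → sumlt (suc n) f ≡ sumlt (suc n) (λ k → f (n ∸ k))
sumlt-reverse zero    f = refl
sumlt-reverse (suc n) f = trans (cong (_+ f (suc n)) (sumlt-reverse n f))
  (trans (ℤ.+-comm _ (f (suc n))) (sym (sumlt-head (suc n) (λ k → f (suc n ∸ k)))))

sumTo-cong : ∀ n {f g} → (∀ k → k ≤ n → f k ≡ g k) → sumTo n f ≡ sumTo n g
sumTo-cong n {f} {g} eq = trans (sumTo≡sumlt n f) (trans (sumlt-cong (suc n) (λ k k<1+n → eq k (ℕ.≤-pred k<1+n))) (sym (sumTo≡sumlt n g)))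

sumTo-*ˡ : ∀ n x f → sumTo n (λ k → x * f k) ≡ x * sumTo n f
sumTo-*ˡ n x f = trans (sumTo≡sumlt n _) (trans (sumlt-*ˡ (suc n) x f) (cong (x *_) (sym (sumTo≡sumlt n f))))

-- The recurrence says that a step in `i` applies 1 + E, where E shifts `j`; this is the binomial
-- theorem for (1 + E)^i. It is applied to powers, to binomial coefficients and to finite
-- differences.
pascal-array : (A : ℕ → ℕ → ℤ) → (∀ i j → A (suc i) j ≡ A i j + A i (suc j)) →
               ∀ i j → A i j ≡ sumlt (suc i) (λ t → bin i t * A 0 (j ℕ.+ t))
pascal-array A step zero    j rewrite ℕ.+-identityʳ j = lem (A 0 j)
  where
  lem : ∀ x → x ≡ 0ℤ + 1ℤ * x
  lem = solve-∀
pascal-array A step (suc i) j = begin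
  A (suc i) j                                     ≡⟨ step i j ⟩
  A i j + A i (suc j)                             ≡⟨ cong₂ _+_ (pascal-array A step i j) (pascal-array A step i (suc j)) ⟩
  sumlt (suc i) (λ t → bin i t * h t) + sumlt (suc i) (λ t → bin i t * A 0 (suc j ℕ.+ t))
    -- The first sum gains the zero term at `suc i`, so that splitting off its head aligns the rest
    -- with the second sum.
    ≡⟨ cong₂ _+_ (sym (trans (cong (λ u → sumlt (suc i) (λ t → bin i t * h t) + u * h (suc i)) (bin-zero (ℕ.n<1+n i))) (ℤ.+-identityʳ (sumlt (suc i) (λ t → bin i t * h t)))))
                 (sumlt-cong (suc i) (λ t _ → cong (λ m → bin i t * A 0 m) (sym (ℕ.+-suc j t)))) ⟩
  sumlt (suc (suc i)) (λ t → bin i t * h t) + sumlt (suc i) (λ t → bin i t * h (suc t))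
    ≡⟨ cong (_+ sumlt (suc i) (λ t → bin i t * h (suc t))) (sumlt-head (suc i) (λ t → bin i t * h t)) ⟩
  1ℤ * h 0 + sumlt (suc i) (λ t → bin i (suc t) * h (suc t)) + sumlt (suc i) (λ t → bin i t * h (suc t))
    ≡⟨ ℤ.+-assoc (1ℤ * h 0) _ _ ⟩
  1ℤ * h 0 + (sumlt (suc i) (λ t → bin i (suc t) * h (suc t)) + sumlt (suc i) (λ t → bin i t * h (suc t)))
    ≡⟨ cong (_+_ (1ℤ * h 0)) (sumlt-+ (suc i) (λ t → bin i (suc t) * h (suc t)) _) ⟨
  1ℤ * h 0 + sumlt (suc i) (λ t → bin i (suc t) * h (suc t) + bin i t * h (suc t))
    ≡⟨ cong (_+_ (1ℤ * h 0)) (sumlt-cong (suc i) (λ t _ → trans (lem (bin i (suc t)) (bin i t) (h (suc t))) (cong (_* h (suc t)) (sym (bin-pascal i t))))) ⟩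
  1ℤ * h 0 + sumlt (suc i) (λ t → bin (suc i) (suc t) * h (suc t))
    ≡⟨ sumlt-head (suc i) (λ t → bin (suc i) t * h t) ⟨
  sumlt (suc (suc i)) (λ t → bin (suc i) t * h t) ∎
  where
  open ≡-Reasoning
  h : ℕ → ℤ
  h t = A 0 (j ℕ.+ t)
  lem : ∀ u v w → u * w + v * w ≡ (v + u) * w
  lem = solve-∀

Δ : (ℕ → ℤ) → ℕ → ℤ
Δ f k = f (suc k) - f k

Δ^ : ℕ → (ℕ → ℤ) → ℕ → ℤ
Δ^ zero    f = f
Δ^ (suc j) f = Δ^ j (Δ f)

-- Makes `Δ^ j f i` an array in the sense of `pascal-array`, which yields Newton's forward
-- difference formula.
Δ^-step : ∀ f i j → Δ^ j f (suc i) ≡ Δ^ j f i + Δ^ (suc j) f i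
Δ^-step f i zero    = lem (f i) (f (suc i))
  where
  lem : ∀ u v → v ≡ u + (v - u)
  lem = solve-∀
Δ^-step f i (suc j) = Δ^-step (Δ f) i j

-- Digits and summands

pos-^ : ∀ m e → + (m ℕ.^ e) ≡ (+ m) ^ e
pos-^ m zero    = refl
pos-^ m (suc e) = trans (ℤ.pos-* m (m ℕ.^ e)) (cong (_*_ (+ m)) (pos-^ m e))

-- Divisibility by C(n,k) serves twice: it forces F(n,k) = 0 for k > n, and F(n,k) ≡ 0 mod p
-- whenever subtracting `k` from `n` in base p needs a borrow.
Supported : (ℕ → ℕ → ℤ) → Set
Supported F = ∀ n k → bin n k ∣ F n k

supported-zero : ∀ {F} → Supported F → ∀ {n k} → n < k → F n k ≡ 0ℤ
supported-zero {F} sup {n} {k} n<k with sup n k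
... | divides q eq = trans eq (trans (cong (q *_) (bin-zero n<k)) (ℤ.*-zeroʳ q))

∸-digits : ∀ q {n₀ k₀ n′ k′} → k₀ ≤ n₀ → k′ ≤ n′ →
           (n₀ ℕ.+ q ℕ.* n′) ∸ (k₀ ℕ.+ q ℕ.* k′) ≡ (n₀ ∸ k₀) ℕ.+ q ℕ.* (n′ ∸ k′)
∸-digits q {n₀} {k₀} {n′} {k′} k₀≤n₀ k′≤n′ = trans
  (cong (_∸ (k₀ ℕ.+ q ℕ.* k′)) (trans (cong₂ (λ i j → i ℕ.+ q ℕ.* j) (sym (ℕ.m+[n∸m]≡n k₀≤n₀)) (sym (ℕ.m+[n∸m]≡n k′≤n′)))
                                     (lem q k₀ (n₀ ∸ k₀) k′ (n′ ∸ k′))))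
  (ℕ.m+n∸m≡n (k₀ ℕ.+ q ℕ.* k′) _)
  where
  lem : ∀ q k i l j → k ℕ.+ i ℕ.+ q ℕ.* (l ℕ.+ j) ≡ k ℕ.+ q ℕ.* l ℕ.+ (i ℕ.+ q ℕ.* j)
  lem = ℕ-Ring.solve-∀

*-digits : ∀ m q n₀ n′ → m ℕ.* (n₀ ℕ.+ q ℕ.* n′) ≡ m ℕ.* n₀ ℕ.+ q ℕ.* (m ℕ.* n′)
*-digits = ℕ-Ring.solve-∀

+-digits : ∀ q n₀ n′ k₀ k′ → n₀ ℕ.+ q ℕ.* n′ ℕ.+ (k₀ ℕ.+ q ℕ.* k′) ≡ n₀ ℕ.+ k₀ ℕ.+ q ℕ.* (n′ ℕ.+ k′)
+-digits = ℕ-Ring.solve-∀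

digits-< : ∀ {q n₀} → n₀ < q → ∀ n′ → n₀ ℕ.+ q ℕ.* n′ < q ℕ.* suc n′
digits-< {q} {n₀} n₀<q n′ = subst (n₀ ℕ.+ q ℕ.* n′ <_) (sym (ℕ.*-suc q n′)) (ℕ.+-monoˡ-< (q ℕ.* n′) n₀<q)

2*k<p+n : ∀ {p n k} → k < p → k ≤ n → 2 ℕ.* k < p ℕ.+ n
2*k<p+n {p} {n} {k} k<p k≤n = subst (_< p ℕ.+ n) (cong (ℕ._+_ k) (sym (ℕ.+-identityʳ k))) (ℕ.+-mono-<-≤ k<p k≤n)

-- 3^(n-3k) n!/(k!³(n-3k)!), factored into binomial coefficients with lower entry k.
f-term : ℕ → ℕ → ℤ
f-term n k = bin n k * (bin (n ∸ k) k * (bin (n ∸ k ∸ k) k * + (3 ℕ.^ (n ∸ k ∸ k ∸ k))))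

-- The third binomial vanishes because n - 2k, truncated at 0, is below `k`. The truncation is
-- harmless since n < 3k forces k > 0.
f-term-zero : ∀ {n k} → n < 3 ℕ.* k → f-term n k ≡ 0ℤ
f-term-zero {n} {zero}        ()
f-term-zero {n} {k@(suc _)} n<3k =
  trans (cong (λ z → bin n k * (bin (n ∸ k) k * (z * + (3 ℕ.^ (n ∸ k ∸ k ∸ k))))) (bin-zero (subst (_< k) (sym (ℕ.∸-+-assoc n k k)) (ℕ.m<n+o⇒m∸n<o n (k ℕ.+ k) (subst (n <_) (lem k) n<3k)))))
        (lem′ (bin n k) (bin (n ∸ k) k) (+ (3 ℕ.^ (n ∸ k ∸ k ∸ k))))
  where
  lem : ∀ k → 3 ℕ.* k ≡ k ℕ.+ k ℕ.+ k
  lem = ℕ-Ring.solve-∀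
  lem′ : ∀ x y z → x * (y * (0ℤ * z)) ≡ 0ℤ
  lem′ = solve-∀

f-term≡ : ∀ {n k} → 3 ℕ.* k ≤ n → + (3 ℕ.^ (n ∸ 3 ℕ.* k)) * (bin n (3 ℕ.* k) * + multi3 k) ≡ f-term n k
f-term≡ {n} {k} 3k≤n = begin
  + (3 ℕ.^ (n ∸ 3 ℕ.* k)) * (bin n (3 ℕ.* k) * + multi3 k)
    ≡⟨ cong₂ (λ i x → + (3 ℕ.^ i) * x) n∸3k (trans (sym (ℤ.pos-* (n C (3 ℕ.* k)) (multi3 k))) (cong +_ (C*multi3≡trinomial {n} {k} 3k≤n))) ⟩
  w * + trinomial n k
    ≡⟨ cong (w *_) (trans (ℤ.pos-* ((n C k) ℕ.* ((n ∸ k) C k)) _) (cong (_* bin (n ∸ k ∸ k) k) (ℤ.pos-* (n C k) _))) ⟩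
  w * (bin n k * bin (n ∸ k) k * bin (n ∸ k ∸ k) k)
    ≡⟨ lem (bin n k) (bin (n ∸ k) k) (bin (n ∸ k ∸ k) k) w ⟩
  f-term n k ∎
  where
  open ≡-Reasoning
  w = + (3 ℕ.^ (n ∸ k ∸ k ∸ k))
  lem : ∀ x y z w → w * (x * y * z) ≡ x * (y * (z * w))
  lem = solve-∀
  n∸3k : n ∸ 3 ℕ.* k ≡ n ∸ k ∸ k ∸ k
  n∸3k = sym (trans (ℕ.∸-+-assoc (n ∸ k) k k) (trans (ℕ.∸-+-assoc n k (k ℕ.+ k)) (cong (λ i → n ∸ (k ℕ.+ (k ℕ.+ i))) (sym (ℕ.+-identityʳ k)))))

-- Brings (f) and (δ) to the range k ≤ n of the other sums, so that the same splitting into digits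
-- applies.
sumTo-/3 : ∀ n {F G : ℕ → ℤ} → (∀ k → 3 ℕ.* k ≤ n → F k ≡ G k) → (∀ k → n < 3 ℕ.* k → G k ≡ 0ℤ) →
           sumTo (n ℕ./ 3) F ≡ sumTo n G
sumTo-/3 n {F} {G} agree vanish = begin
  sumTo (n ℕ./ 3) F         ≡⟨ sumTo-cong (n ℕ./ 3) (λ k k≤ → agree k (ℕ.≤-trans (ℕ.*-monoʳ-≤ 3 k≤) (subst (_≤ n) (ℕ.*-comm (n ℕ./ 3) 3) (ℕ.m/n*n≤m n 3)))) ⟩
  sumTo (n ℕ./ 3) G         ≡⟨ sumTo≡sumlt (n ℕ./ 3) G ⟩
  sumlt (suc (n ℕ./ 3)) G   ≡⟨ sumlt-extend G (s≤s (ℕ.m/n≤m n 3)) (λ k <k → vanish k (ℕ.<-≤-trans n< (ℕ.*-monoʳ-≤ 3 <k))) ⟨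
  sumlt (suc n) G           ≡⟨ sumTo≡sumlt n G ⟨
  sumTo n G                 ∎
  where
  open ≡-Reasoning
  n< : n < 3 ℕ.* suc (n ℕ./ 3)
  n< = subst (_< 3 ℕ.* suc (n ℕ./ 3)) (sym (trans (ℕ.m≡m%n+[m/n]*n n 3) (cong (ℕ._+_ (n ℕ.% 3)) (ℕ.*-comm (n ℕ./ 3) 3))))
             (digits-< (ℕ.m%n<n n 3) (n ℕ./ 3))

-- The sums U of (η) and (s₁₈)

x≡-x⇒x≡0 : ∀ x → x ≡ -1ℤ * x → x ≡ 0ℤ
x≡-x⇒x≡0 (+ zero)  _ = refl
x≡-x⇒x≡0 (+ suc n) ()
x≡-x⇒x≡0 -[1+ n ]  ()

entry : ℕ → ℕ → ℕ → ℤ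
entry c n k = + suc c * + n - + suc (suc c) * + k

entry-pos : ∀ c n k → + (suc c ℕ.* n) - + (suc (suc c) ℕ.* k) ≡ entry c n k
entry-pos c n k = cong₂ _-_ (ℤ.pos-* (suc c) n) (ℤ.pos-* (suc (suc c)) k)

entry-digits : ∀ c q n₀ n′ k₀ k′ → entry c (n₀ ℕ.+ q ℕ.* n′) (k₀ ℕ.+ q ℕ.* k′) ≡ entry c n₀ k₀ + + q * entry c n′ k′
entry-digits c q n₀ n′ k₀ k′ =
  trans (cong₂ (λ x y → + suc c * x - + suc (suc c) * y) (pos-digits n₀ n′) (pos-digits k₀ k′))
        (lem (+ suc c) (+ suc (suc c)) (+ q) (+ n₀) (+ n′) (+ k₀) (+ k′))
  where
  pos-digits : ∀ i j → + (i ℕ.+ q ℕ.* j) ≡ + i + + q * + j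
  pos-digits i j = trans (ℤ.pos-+ i (q ℕ.* j)) (cong (_+_ (+ i)) (ℤ.pos-* q j))
  lem : ∀ a b q n₀ n′ k₀ k′ → a * (n₀ + q * n′) - b * (k₀ + q * k′) ≡ a * n₀ - b * k₀ + q * (a * n′ - b * k′)
  lem = solve-∀

module Twisted
  (w : ℕ → ℕ → ℤ) (w-reflect : ∀ {n k} → k ≤ n → w n (n ∸ k) ≡ sgn n * w n k)
  (c : ℕ) (c-odd : ∀ n → sgn (c ℕ.* n) ≡ sgn n) where

  -- The shifts `j` and `i` record the carries that the low digits pass to the upper and the lower
  -- entry.
  U : ℤ → ℕ → ℕ → ℤ
  U j i n = sumlt (suc n) (λ k → w n k * B (entry c n k + j) (c ℕ.* n ℕ.+ i))

  U-pascal : ∀ j i n → U (1ℤ + j) (suc i) n ≡ U j i n + U j (suc i) n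
  U-pascal j i n = trans (sumlt-cong (suc n) (λ k _ → step k)) (sumlt-+ (suc n) _ _)
    where
    m = c ℕ.* n ℕ.+ i
    shift : ∀ x j → x + (1ℤ + j) ≡ 1ℤ + (x + j)
    shift = solve-∀
    step : ∀ k → w n k * B (entry c n k + (1ℤ + j)) (c ℕ.* n ℕ.+ suc i) ≡
           w n k * B (entry c n k + j) m + w n k * B (entry c n k + j) (c ℕ.* n ℕ.+ suc i)
    step k = begin
      w n k * B (entry c n k + (1ℤ + j)) (c ℕ.* n ℕ.+ suc i)          ≡⟨ cong (w n k *_) (cong₂ B (shift (entry c n k) j) (ℕ.+-suc (c ℕ.* n) i)) ⟩
      w n k * B (1ℤ + (entry c n k + j)) (suc m)                      ≡⟨ cong (w n k *_) (B-pascal (entry c n k + j) m) ⟩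
      w n k * (B (entry c n k + j) m + B (entry c n k + j) (suc m))   ≡⟨ ℤ.*-distribˡ-+ (w n k) _ _ ⟩
      w n k * B (entry c n k + j) m + w n k * B (entry c n k + j) (suc m) ≡⟨ cong (λ l → w n k * B (entry c n k + j) m + w n k * B (entry c n k + j) l) (ℕ.+-suc (c ℕ.* n) i) ⟨
      w n k * B (entry c n k + j) m + w n k * B (entry c n k + j) (c ℕ.* n ℕ.+ suc i) ∎
      where open ≡-Reasoning

  -- Reversing the sum gives a sign (-1)^n from the weight, and `B-reflect` gives (-1)^(cn+i). As c
  -- is odd, only (-1)^i survives.
  U-reflect : ∀ j i n → U j i n ≡ sgn i * U (+ i - 1ℤ - j) i n
  U-reflect j i n = trans (sumlt-reverse n _) (trans (sumlt-cong (suc n) (λ k k<1+n → step k (ℕ.≤-pred k<1+n))) (sumlt-*ˡ (suc n) (sgn i) _))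
    where
    open ≡-Reasoning
    m = c ℕ.* n ℕ.+ i
    lem : ∀ c k l i j → c * (k + l) + i - 1ℤ - ((1ℤ + c) * (k + l) - (1ℤ + (1ℤ + c)) * l + j) ≡
          (1ℤ + c) * (k + l) - (1ℤ + (1ℤ + c)) * k + (i - 1ℤ - j)
    lem = solve-∀
    entry-reflect : ∀ k → k ≤ n → + m - 1ℤ - (entry c n (n ∸ k) + j) ≡ entry c n k + (+ i - 1ℤ - j)
    entry-reflect k k≤n = begin
      + m - 1ℤ - (entry c n l + j)                                 ≡⟨ cong (λ x → x - 1ℤ - (entry c n l + j)) (trans (ℤ.pos-+ (c ℕ.* n) i) (cong (_+ + i) (ℤ.pos-* c n))) ⟩
      + c * + n + + i - 1ℤ - (entry c n l + j)                     ≡⟨ cong (λ x → + c * x + + i - 1ℤ - (+ suc c * x - + suc (suc c) * + l + j)) n≡ ⟩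
      + c * (+ k + + l) + + i - 1ℤ - (+ suc c * (+ k + + l) - + suc (suc c) * + l + j) ≡⟨ lem (+ c) (+ k) (+ l) (+ i) j ⟩
      + suc c * (+ k + + l) - + suc (suc c) * + k + (+ i - 1ℤ - j) ≡⟨ cong (λ x → + suc c * x - + suc (suc c) * + k + (+ i - 1ℤ - j)) n≡ ⟨
      entry c n k + (+ i - 1ℤ - j) ∎
      where
      l = n ∸ k
      n≡ : + n ≡ + k + + l
      n≡ = trans (cong +_ (sym (ℕ.m+[n∸m]≡n k≤n))) (ℤ.pos-+ k l)
    signs : ∀ s t x y → s * x * (s * t * y) ≡ s * s * (t * (x * y))
    signs = solve-∀
    step : ∀ k → k ≤ n → w n (n ∸ k) * B (entry c n (n ∸ k) + j) m ≡ sgn i * (w n k * B (entry c n k + (+ i - 1ℤ - j)) m)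
    step k k≤n = begin
      w n (n ∸ k) * B (entry c n (n ∸ k) + j) m
        ≡⟨ cong₂ _*_ (w-reflect k≤n) (trans (B-reflect (entry c n (n ∸ k) + j) m)
             (cong₂ _*_ (trans (ℤ.^-distribˡ-+-* -1ℤ (c ℕ.* n) i) (cong (_* sgn i) (c-odd n))) (cong (λ x → B x m) (entry-reflect k k≤n)))) ⟩
      sgn n * w n k * (sgn n * sgn i * B (entry c n k + (+ i - 1ℤ - j)) m)
        ≡⟨ signs (sgn n) (sgn i) (w n k) _ ⟩
      sgn n * sgn n * (sgn i * (w n k * B (entry c n k + (+ i - 1ℤ - j)) m))
        ≡⟨ cong (_* (sgn i * (w n k * B (entry c n k + (+ i - 1ℤ - j)) m))) (sgn² n) ⟩
      1ℤ * (sgn i * (w n k * B (entry c n k + (+ i - 1ℤ - j)) m))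
        ≡⟨ ℤ.*-identityˡ _ ⟩
      sgn i * (w n k * B (entry c n k + (+ i - 1ℤ - j)) m) ∎

  S : ℕ → ℤ
  S = U 0ℤ 0

  -- The part of U(e,i) that is independent of e and not a multiple of S. Only carries i < 3 are
  -- evaluated; among them it is present for i = 2 alone.
  defect : ℕ → ℕ → ℤ
  defect 2 n = U 0ℤ 2 n
  defect _ n = 0ℤ

  -- The quotients e that `entry-quotient` leaves possible, and for which `U-eval` determines
  -- U(e,i).
  InRange : ℤ → ℕ → Set
  InRange e i = e ≡ -1ℤ ⊎ ∃ λ j → j ≤ i × e ≡ + j

  U₋₁₀ : ∀ n → U -1ℤ 0 n ≡ S n
  U₋₁₀ n = sym (trans (U-reflect 0ℤ 0 n) (ℤ.*-identityˡ _))

  -- For i = 1 the reflection j ↦ i-1-j fixes j = 0 and has sign -1, so the value equals its own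
  -- negative.
  U₀₁ : ∀ n → U 0ℤ 1 n ≡ 0ℤ
  U₀₁ n = x≡-x⇒x≡0 (U 0ℤ 1 n) (U-reflect 0ℤ 1 n)

  U₁₁ : ∀ n → U 1ℤ 1 n ≡ S n
  U₁₁ n = trans (U-pascal 0ℤ 0 n) (trans (cong (_+_ (S n)) (U₀₁ n)) (ℤ.+-identityʳ (S n)))

  U₋₁₁ : ∀ n → U -1ℤ 1 n ≡ - S n
  U₋₁₁ n = trans (lem (U -1ℤ 0 n) (U -1ℤ 1 n)) (trans (cong₂ _-_ (trans (sym (U-pascal -1ℤ 0 n)) (U₀₁ n)) (U₋₁₀ n)) (ℤ.+-identityˡ (- S n)))
    where
    lem : ∀ u v → v ≡ u + v - u
    lem = solve-∀

  U₁₂ : ∀ n → U 1ℤ 2 n ≡ U 0ℤ 2 n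
  U₁₂ n = trans (U-reflect 1ℤ 2 n) (ℤ.*-identityˡ _)

  U₂₂ : ∀ n → U (+ 2) 2 n ≡ S n + U 0ℤ 2 n
  U₂₂ n = trans (U-pascal 1ℤ 1 n) (cong₂ _+_ (U₁₁ n) (U₁₂ n))

  -- With d = U(0,2), the values for e = -1, 0, ..., i are S, S when i = 0; then -S, 0, S when i =
  -- 1; then S+d, d, d, S+d when i = 2. The multiples of S are the coefficients C(e,i).
  U-eval : ∀ e i n → i < 3 → InRange e i → U e i n ≡ B e i * S n + defect i n
  U-eval e 0 n _ (inj₁ refl)              = trans (U₋₁₀ n) (lem (S n))
    where
    lem : ∀ s → s ≡ 1ℤ * s + 0ℤ
    lem = solve-∀
  U-eval e 0 n _ (inj₂ (0 , _ , refl))    = lem (S n)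
    where
    lem : ∀ s → s ≡ 1ℤ * s + 0ℤ
    lem = solve-∀
  U-eval e 1 n _ (inj₁ refl)              = trans (U₋₁₁ n) (lem (S n))
    where
    lem : ∀ s → - s ≡ -1ℤ * s + 0ℤ
    lem = solve-∀
  U-eval e 1 n _ (inj₂ (0 , _ , refl))    = U₀₁ n
  U-eval e 1 n _ (inj₂ (1 , _ , refl))    = trans (U₁₁ n) (lem (S n))
    where
    lem : ∀ s → s ≡ 1ℤ * s + 0ℤ
    lem = solve-∀
  U-eval e 2 n _ (inj₁ refl)              = trans (trans (U-reflect -1ℤ 2 n) (ℤ.*-identityˡ _)) (trans (U₂₂ n) (cong (_+ U 0ℤ 2 n) (sym (ℤ.*-identityˡ (S n)))))
  U-eval e 2 n _ (inj₂ (0 , _ , refl))    = sym (ℤ.+-identityˡ _)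
  U-eval e 2 n _ (inj₂ (1 , _ , refl))    = trans (U₁₂ n) (sym (ℤ.+-identityˡ _))
  U-eval e 2 n _ (inj₂ (2 , _ , refl))    = trans (U₂₂ n) (cong (_+ U 0ℤ 2 n) (sym (ℤ.*-identityˡ (S n))))
  U-eval e 0 n _ (inj₂ (suc _ , () , _))
  U-eval e 1 n _ (inj₂ (suc (suc _) , s≤s () , _))
  U-eval e 2 n _ (inj₂ (suc (suc (suc _)) , s≤s (s≤s ()) , _))
  U-eval e (suc (suc (suc _))) n (s≤s (s≤s (s≤s ()))) _

  -- Above: the entry is at most n₀ + cn₀ < q + r + qi ≤ x₀ + (i+1)q, hence e ≤ i. Below: k₀ ≤ n₀
  -- makes the entry at least -n₀ > -q, and x₀ < q then gives e ≥ -1.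
  entry-quotient : ∀ {q n₀ k₀ x₀ r i e} → n₀ < q → k₀ ≤ n₀ → x₀ < q → r ≤ x₀ → c ℕ.* n₀ ≡ r ℕ.+ q ℕ.* i →
                   entry c n₀ k₀ ≡ + x₀ + e * + q → InRange e i
  entry-quotient {q} {n₀} {k₀} {x₀} {r} {i} {+ j} n₀<q k₀≤n₀ x₀<q r≤x₀ cn₀≡ eq with j ℕ.≤? i
  ... | yes j≤i = inj₂ (j , j≤i , refl)
  ... | no j≰i  = contradiction bound (ℕ.<-irrefl eqℕ)
    where
    lem : ∀ a b x → a - b ≡ x → a ≡ x + b
    lem a b x e = trans (solve₁ a b) (cong (_+ b) e)
      where
      solve₁ : ∀ a b → a ≡ a - b + b
      solve₁ = solve-∀
    eqℕ : suc c ℕ.* n₀ ≡ x₀ ℕ.+ j ℕ.* q ℕ.+ suc (suc c) ℕ.* k₀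
    eqℕ = ℤ.+-injective (trans (lem (+ (suc c ℕ.* n₀)) (+ (suc (suc c) ℕ.* k₀)) (+ x₀ + + j * + q) (trans (entry-pos c n₀ k₀) eq))
      (sym (trans (ℤ.pos-+ (x₀ ℕ.+ j ℕ.* q) _) (cong (_+ + (suc (suc c) ℕ.* k₀)) (trans (ℤ.pos-+ x₀ (j ℕ.* q)) (cong (_+_ (+ x₀)) (ℤ.pos-* j q)))))))
    bound : suc c ℕ.* n₀ < x₀ ℕ.+ j ℕ.* q ℕ.+ suc (suc c) ℕ.* k₀
    bound = begin-strict
      n₀ ℕ.+ c ℕ.* n₀               ≡⟨ cong (ℕ._+_ n₀) cn₀≡ ⟩
      n₀ ℕ.+ (r ℕ.+ q ℕ.* i)        <⟨ ℕ.+-monoˡ-< (r ℕ.+ q ℕ.* i) n₀<q ⟩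
      q ℕ.+ (r ℕ.+ q ℕ.* i)         ≡⟨ assoc q r i ⟩
      r ℕ.+ suc i ℕ.* q             ≤⟨ ℕ.+-mono-≤ r≤x₀ (ℕ.*-monoˡ-≤ q (ℕ.≰⇒> j≰i)) ⟩
      x₀ ℕ.+ j ℕ.* q                ≤⟨ ℕ.m≤m+n _ _ ⟩
      x₀ ℕ.+ j ℕ.* q ℕ.+ suc (suc c) ℕ.* k₀ ∎
      where
      open ℕ.≤-Reasoning
      assoc : ∀ q r i → q ℕ.+ (r ℕ.+ q ℕ.* i) ≡ r ℕ.+ suc i ℕ.* q
      assoc = ℕ-Ring.solve-∀
  entry-quotient {e = -[1+ zero ]} _ _ _ _ _ _ = inj₁ refl
  -- Here e = -(m+2); both sides are moved to natural numbers to contradict the lower bound on the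
  -- entry.
  entry-quotient {q} {n₀} {k₀} {x₀} {r} {i} { -[1+ suc m ]} n₀<q k₀≤n₀ x₀<q r≤x₀ cn₀≡ eq = contradiction bound (ℕ.<-irrefl (sym eqℕ))
    where
    lem : ∀ a b x m q → a - b ≡ x + - m * q → a + m * q ≡ x + b
    lem a b x m q e = trans (solve₁ a b (m * q)) (trans (cong (λ y → y + b + m * q) e) (solve₂ x b m q))
      where
      solve₁ : ∀ a b c → a + c ≡ a - b + b + c
      solve₁ = solve-∀
      solve₂ : ∀ x b m q → x + - m * q + b + m * q ≡ x + b
      solve₂ = solve-∀
    eqℕ : suc c ℕ.* n₀ ℕ.+ suc (suc m) ℕ.* q ≡ x₀ ℕ.+ suc (suc c) ℕ.* k₀
    eqℕ = ℤ.+-injective (trans (trans (ℤ.pos-+ (suc c ℕ.* n₀) _) (cong (_+_ (+ (suc c ℕ.* n₀))) (ℤ.pos-* (suc (suc m)) q)))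
      (trans (lem (+ (suc c ℕ.* n₀)) (+ (suc (suc c) ℕ.* k₀)) (+ x₀) (+ suc (suc m)) (+ q) (trans (entry-pos c n₀ k₀) eq))
             (sym (ℤ.pos-+ x₀ _))))
    bound : x₀ ℕ.+ suc (suc c) ℕ.* k₀ < suc c ℕ.* n₀ ℕ.+ suc (suc m) ℕ.* q
    bound = begin-strict
      x₀ ℕ.+ suc (suc c) ℕ.* k₀              <⟨ ℕ.+-mono-<-≤ x₀<q (ℕ.*-monoʳ-≤ (suc (suc c)) k₀≤n₀) ⟩
      q ℕ.+ (n₀ ℕ.+ suc c ℕ.* n₀)            ≤⟨ ℕ.+-monoʳ-≤ q (ℕ.+-monoˡ-≤ (suc c ℕ.* n₀) (ℕ.<⇒≤ n₀<q)) ⟩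
      q ℕ.+ (q ℕ.+ suc c ℕ.* n₀)             ≤⟨ ℕ.m≤m+n _ (m ℕ.* q) ⟩
      q ℕ.+ (q ℕ.+ suc c ℕ.* n₀) ℕ.+ m ℕ.* q ≡⟨ assoc q (suc c ℕ.* n₀) m ⟩
      suc c ℕ.* n₀ ℕ.+ suc (suc m) ℕ.* q     ∎
      where
      open ℕ.≤-Reasoning
      assoc : ∀ q x m → q ℕ.+ (q ℕ.+ x) ℕ.+ m ℕ.* q ≡ x ℕ.+ suc (suc m) ℕ.* q
      assoc = ℕ-Ring.solve-∀

η-weight : ℕ → ℕ → ℤ
η-weight n k = sgn k * bin n k ^ 3

η-weight-reflect : ∀ {n k} → k ≤ n → η-weight n (n ∸ k) ≡ sgn n * η-weight n k
η-weight-reflect {n} {k} k≤n = trans (cong₂ (λ s x → s * x ^ 3) (sgn-∸ k≤n) (bin-∸ k≤n)) (ℤ.*-assoc (sgn n) (sgn k) _)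

sgn-3* : ∀ n → sgn (3 ℕ.* n) ≡ sgn n
sgn-3* n = trans (ℤ.^-distribˡ-+-* -1ℤ n (n ℕ.+ (n ℕ.+ 0)))
  (trans (cong (sgn n *_) (trans (ℤ.^-distribˡ-+-* -1ℤ n (n ℕ.+ 0)) (trans (cong (λ m → sgn n * sgn m) (ℕ.+-identityʳ n)) (sgn² n)))) (ℤ.*-identityʳ (sgn n)))

s18-weight : ℕ → ℕ → ℤ
s18-weight n k = sgn k * bin n k * bin (2 ℕ.* k) k * bin (2 ℕ.* (n ∸ k)) (n ∸ k)

s18-weight-reflect : ∀ {n k} → k ≤ n → s18-weight n (n ∸ k) ≡ sgn n * s18-weight n k
s18-weight-reflect {n} {k} k≤n =
  trans (cong₂ (λ s x → s * x * central (n ∸ k) * central (n ∸ (n ∸ k))) (sgn-∸ k≤n) (bin-∸ k≤n))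
  (trans (cong (λ m → sgn n * sgn k * bin n k * central (n ∸ k) * central m) (ℕ.m∸[m∸n]≡n k≤n))
         (lem (sgn n) (sgn k) (bin n k) (central k) (central (n ∸ k))))
  where
  central : ℕ → ℤ
  central k = bin (2 ℕ.* k) k
  lem : ∀ s t x y z → s * t * x * z * y ≡ s * (t * x * y * z)
  lem = solve-∀

-- Arithmetic modulo p

module Modular (p : ℕ) (p-prime : Prime p) where

  instance
    p≢0 : NonZero p
    p≢0 = prime⇒nonZero p-prime

  infix 4 _≈_
  -- A record rather than a synonym for divisibility, so that `x` and `y` can be recovered from the
  -- type `x ≈ y`.
  record _≈_ (x y : ℤ) : Set where
    constructor modulo
    field p∣x-y : + p ∣ x - y
  open _≈_ public

  ≈-reflexive : ∀ {x y} → x ≡ y → x ≈ y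
  ≈-reflexive {x} refl = modulo (divides 0ℤ (ℤ.i≡j⇒i-j≡0 {x} refl))

  ≈-refl : ∀ {x} → x ≈ x
  ≈-refl = ≈-reflexive refl

  ≈-sym : ∀ {x y} → x ≈ y → y ≈ x
  ≈-sym {x} {y} (modulo d) = modulo (subst (+ p ∣_) (lem x y) (∣m⇒∣-m d))
    where
    lem : ∀ x y → - (x - y) ≡ y - x
    lem = solve-∀

  ≈-trans : ∀ {x y z} → x ≈ y → y ≈ z → x ≈ z
  ≈-trans {x} {y} {z} (modulo d) (modulo e) = modulo (subst (+ p ∣_) (lem x y z) (∣m∣n⇒∣m+n d e))
    where
    lem : ∀ x y z → x - y + (y - z) ≡ x - z
    lem = solve-∀

  +-cong : ∀ {x y u v} → x ≈ y → u ≈ v → x + u ≈ y + v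
  +-cong {x} {y} {u} {v} (modulo d) (modulo e) = modulo (subst (+ p ∣_) (lem x y u v) (∣m∣n⇒∣m+n d e))
    where
    lem : ∀ x y u v → x - y + (u - v) ≡ x + u - (y + v)
    lem = solve-∀

  *-cong : ∀ {x y u v} → x ≈ y → u ≈ v → x * u ≈ y * v
  *-cong {x} {y} {u} {v} (modulo d) (modulo e) =
    modulo (subst (+ p ∣_) (lem x y u v) (∣m∣n⇒∣m+n (∣m⇒∣m*n u d) (∣n⇒∣m*n y e)))
    where
    lem : ∀ x y u v → (x - y) * u + y * (u - v) ≡ x * u - y * v
    lem = solve-∀

  neg-cong : ∀ {x y} → x ≈ y → - x ≈ - y
  neg-cong {x} {y} (modulo d) = modulo (subst (+ p ∣_) (lem x y) (∣m⇒∣-m d))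
    where
    lem : ∀ x y → - (x - y) ≡ - x - - y
    lem = solve-∀

  ^-cong : ∀ {x y} n → x ≈ y → x ^ n ≈ y ^ n
  ^-cong zero    e = ≈-refl
  ^-cong (suc n) e = *-cong e (^-cong n e)

  ≈-setoid : Setoid _ _
  ≈-setoid = record { Carrier = ℤ ; _≈_ = _≈_ ; isEquivalence = record { refl = ≈-refl ; sym = ≈-sym ; trans = ≈-trans } }

  open import Relation.Binary.Reasoning.Setoid ≈-setoid

  *-zeroˡ : ∀ {x} y → x ≈ 0ℤ → x * y ≈ 0ℤ
  *-zeroˡ y e = *-cong e (≈-refl {y})

  *-zeroʳ : ∀ x {y} → y ≈ 0ℤ → x * y ≈ 0ℤ
  *-zeroʳ x e = ≈-trans (*-cong (≈-refl {x}) e) (≈-reflexive (ℤ.*-zeroʳ x))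

  p*x≈0 : ∀ x → + p * x ≈ 0ℤ
  p*x≈0 x = modulo (subst (+ p ∣_) (sym (ℤ.+-identityʳ (+ p * x))) (∣m⇒∣m*n x ∣-refl))

  p+x≈x : ∀ x → + p + x ≈ x
  p+x≈x x = modulo (divides 1ℤ (lem (+ p) x))
    where
    lem : ∀ p x → p + x - x ≡ 1ℤ * p
    lem = solve-∀

  -- Euclid's lemma: p divides one of the factors, and `suc k` is positive and smaller than p.
  *-cancelˡ : ∀ {k} → suc k < p → ∀ {x y} → + suc k * x ≈ + suc k * y → x ≈ y
  *-cancelˡ {k} k<p {x} {y} (modulo d)
    with euclidsLemma (suc k) ∣ x - y ∣ p-prime
           (subst (ℕ._∣_ p) (trans (cong ∣_∣ (lem (+ suc k) x y)) (ℤ.abs-* (+ suc k) (x - y))) (∣⇒∣ᵤ d))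
    where
    lem : ∀ k x y → k * x - k * y ≡ k * (x - y)
    lem = solve-∀
  ... | inj₁ p∣k = contradiction (ℕ.∣⇒≤ p∣k) (ℕ.<⇒≱ k<p)
  ... | inj₂ p∣x-y = modulo (∣ᵤ⇒∣ p∣x-y)

  sum-cong : ∀ n {f g} → (∀ k → k < n → f k ≈ g k) → sumlt n f ≈ sumlt n g
  sum-cong zero    e = ≈-refl
  sum-cong (suc n) e = +-cong (sum-cong n (λ k k<n → e k (ℕ.m<n⇒m<1+n k<n))) (e n ℕ.≤-refl)

  sum-zero : ∀ n {f} → (∀ k → k < n → f k ≈ 0ℤ) → sumlt n f ≈ 0ℤ
  sum-zero n e = ≈-trans (sum-cong n e) (≈-reflexive (sumlt-0 n))

  -- The theorems of Fermat and Lucas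

  -- Absorption gives (k+1) C(p,k+1) = p C(p-1,k), and k+1 < p can be cancelled.
  bin-p≈0 : ∀ k → suc k < p → bin p (suc k) ≈ 0ℤ
  bin-p≈0 k k<p = *-cancelˡ k<p (begin
    + suc k * bin p (suc k)            ≡⟨ cong (λ n → + suc k * bin n (suc k)) p≡ ⟨
    + suc k * bin (suc q) (suc k)      ≡⟨ B-absorb-upper (+ q) k ⟩
    + suc q * bin q k                  ≡⟨ cong (λ n → + n * bin q k) p≡ ⟩
    + p * bin q k                      ≈⟨ p*x≈0 (bin q k) ⟩
    0ℤ                                 ≡⟨ ℤ.*-zeroʳ (+ suc k) ⟨
    + suc k * 0ℤ                       ∎)
    where
    q = ℕ.pred p
    p≡ : suc q ≡ p
    p≡ = ℕ.suc-pred p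

  -- The freshman's dream (1 + E)^p ≈ 1 + E^p, for the shift E in the second index.
  pascal-array-p : (A : ℕ → ℕ → ℤ) → (∀ i j → A (suc i) j ≡ A i j + A i (suc j)) →
                   ∀ j → A p j ≈ A 0 j + A 0 (j ℕ.+ p)
  pascal-array-p A step j = begin
    A p j                                            ≡⟨ pascal-array A step p j ⟩
    sumlt p h + h p                                  ≡⟨ cong (λ n → sumlt n h + h p) (ℕ.suc-pred p) ⟨
    sumlt (suc q) h + h p                            ≡⟨ cong (_+ h p) (sumlt-head q h) ⟩
    h 0 + sumlt q (λ t → h (suc t)) + h p            ≈⟨ +-cong (+-cong (≈-refl {h 0}) (sum-zero q (λ t t<q → *-zeroˡ (A 0 (j ℕ.+ suc t)) (bin-p≈0 t (subst (suc t <_) (ℕ.suc-pred p) (s≤s t<q)))))) ≈-refl ⟩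
    h 0 + 0ℤ + h p                                   ≡⟨ cong (λ u → h 0 + 0ℤ + u * A 0 (j ℕ.+ p)) (bin-full p) ⟩
    h 0 + 0ℤ + 1ℤ * A 0 (j ℕ.+ p)                    ≡⟨ lem (A 0 (j ℕ.+ 0)) (A 0 (j ℕ.+ p)) ⟩
    A 0 (j ℕ.+ 0) + A 0 (j ℕ.+ p)                    ≡⟨ cong (λ m → A 0 m + A 0 (j ℕ.+ p)) (ℕ.+-identityʳ j) ⟩
    A 0 j + A 0 (j ℕ.+ p)                            ∎
    where
    q = ℕ.pred p
    h : ℕ → ℤ
    h t = bin p t * A 0 (j ℕ.+ t)
    lem : ∀ x y → 1ℤ * x + 0ℤ + 1ℤ * y ≡ x + y
    lem = solve-∀

  -- The array (1+x)^i x^j obeys Pascal's recurrence, so the freshman's dream gives (1+x)^p ≈ 1 +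
  -- x^p. Induction over the integers follows in both directions.
  fermat : ∀ x → x ^ p ≈ x
  fermat = ℤ-induction (λ x → x ^ p ≈ x) base up down
    where
    base : 0ℤ ^ p ≈ 0ℤ
    base = ≈-reflexive (cong (0ℤ ^_) (sym (ℕ.suc-pred p)))
    binomial : ∀ x → (1ℤ + x) ^ p ≈ 1ℤ + x ^ p
    binomial x = begin
      (1ℤ + x) ^ p               ≡⟨ ℤ.*-identityʳ _ ⟨
      (1ℤ + x) ^ p * x ^ 0       ≈⟨ pascal-array-p (λ i j → (1ℤ + x) ^ i * x ^ j) (λ i j → lem x ((1ℤ + x) ^ i) (x ^ j)) 0 ⟩
      1ℤ * 1ℤ + 1ℤ * x ^ p       ≡⟨ cong (_+_ 1ℤ) (ℤ.*-identityˡ (x ^ p)) ⟩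
      1ℤ + x ^ p                 ∎
      where
      lem : ∀ x u v → (1ℤ + x) * u * v ≡ u * v + u * (x * v)
      lem = solve-∀
    up : ∀ x → x ^ p ≈ x → (1ℤ + x) ^ p ≈ 1ℤ + x
    up x e = ≈-trans (binomial x) (+-cong (≈-refl {1ℤ}) e)
    down : ∀ x → (1ℤ + x) ^ p ≈ 1ℤ + x → x ^ p ≈ x
    down x e = begin
      x ^ p                   ≡⟨ lem (x ^ p) ⟩
      -1ℤ + (1ℤ + x ^ p)      ≈⟨ +-cong (≈-refl { -1ℤ}) (≈-trans (≈-sym (binomial x)) e) ⟩
      -1ℤ + (1ℤ + x)          ≡⟨ lem x ⟨
      x                       ∎
      where
      lem : ∀ u → u ≡ -1ℤ + (1ℤ + u)
      lem = solve-∀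

  ^-lucas : ∀ x k₀ k′ → x ^ (k₀ ℕ.+ p ℕ.* k′) ≈ x ^ k₀ * x ^ k′
  ^-lucas x k₀ k′ = begin
    x ^ (k₀ ℕ.+ p ℕ.* k′)      ≡⟨ ℤ.^-distribˡ-+-* x k₀ (p ℕ.* k′) ⟩
    x ^ k₀ * x ^ (p ℕ.* k′)    ≡⟨ cong (_*_ (x ^ k₀)) (ℤ.^-*-assoc x p k′) ⟨
    x ^ k₀ * (x ^ p) ^ k′      ≈⟨ *-cong (≈-refl {x ^ k₀}) (^-cong k′ (fermat x)) ⟩
    x ^ k₀ * x ^ k′            ∎

  -- Induction on `m` through absorption: the factor `x - m` is periodic modulo p, and the
  -- denominators up to `m` are invertible because m < p.
  B-period : ∀ {m} → m < p → ∀ x → B (+ p + x) m ≈ B x m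
  B-period {zero}  _   x = ≈-reflexive (trans (B-0 (+ p + x)) (sym (B-0 x)))
  B-period {suc m} m<p x = *-cancelˡ m<p (begin
    + suc m * B (+ p + x) (suc m)       ≡⟨ B-absorb (+ p + x) m ⟩
    B (+ p + x) m * (+ p + x - + m)     ≈⟨ *-cong (B-period (ℕ.<-trans (ℕ.n<1+n m) m<p) x) (+-cong (p+x≈x x) ≈-refl) ⟩
    B x m * (x - + m)                   ≡⟨ B-absorb x m ⟨
    + suc m * B x (suc m)               ∎)

  B-period-* : ∀ {m} → m < p → ∀ y x → B (x + + p * y) m ≈ B x m
  B-period-* {m} m<p = ℤ-induction (λ y → ∀ x → B (x + + p * y) m ≈ B x m) base up down
    where
    shift : ∀ p x y → x + p * (1ℤ + y) ≡ p + (x + p * y)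
    shift = solve-∀
    step : ∀ x y → B (x + + p * (1ℤ + y)) m ≈ B (x + + p * y) m
    step x y = ≈-trans (≈-reflexive (cong (λ z → B z m) (shift (+ p) x y))) (B-period m<p (x + + p * y))
    lem : ∀ p x → x + p * 0ℤ ≡ x
    lem = solve-∀
    base : ∀ x → B (x + + p * 0ℤ) m ≈ B x m
    base x = ≈-reflexive (cong (λ z → B z m) (lem (+ p) x))
    up : ∀ y → (∀ x → B (x + + p * y) m ≈ B x m) → ∀ x → B (x + + p * (1ℤ + y)) m ≈ B x m
    up y ih x = ≈-trans (step x y) (ih x)
    down : ∀ y → (∀ x → B (x + + p * (1ℤ + y)) m ≈ B x m) → ∀ x → B (x + + p * y) m ≈ B x m
    down y ih x = ≈-trans (≈-sym (step x y)) (ih x)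

  -- Raising both entries together turns Pascal's rule into an array recurrence, with the shift
  -- acting on the lower entry alone; the freshman's dream then applies.
  B-shift : ∀ x m → B (+ p + x) (p ℕ.+ m) ≈ B x m + B x (p ℕ.+ m)
  B-shift x m = ≈-trans (pascal-array-p (λ i j → B (+ i + x) (i ℕ.+ (j ℕ.+ m))) step 0)
                        (≈-reflexive (cong (λ y → B y m + B y (p ℕ.+ m)) (ℤ.+-identityˡ x)))
    where
    step : ∀ i j → B (+ suc i + x) (suc i ℕ.+ (j ℕ.+ m)) ≡ B (+ i + x) (i ℕ.+ (j ℕ.+ m)) + B (+ i + x) (i ℕ.+ (suc j ℕ.+ m))
    step i j = trans (cong (λ y → B y (suc (i ℕ.+ (j ℕ.+ m)))) (ℤ.+-assoc 1ℤ (+ i) x))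
               (trans (B-pascal (+ i + x) (i ℕ.+ (j ℕ.+ m)))
                      (cong (λ n → B (+ i + x) (i ℕ.+ (j ℕ.+ m)) + B (+ i + x) n) (sym (ℕ.+-suc i (j ℕ.+ m)))))

  -- Lucas' theorem with an integer upper entry. In (x′, m′) both sides obey Pascal's rule, by
  -- `B-shift`, and agree along m′ = 0, by `B-period`; integer induction on `x′` finishes.
  B-lucas : ∀ {x₀ m₀} → x₀ < p → m₀ < p → ∀ x′ m′ →
            B (+ x₀ + + p * x′) (m₀ ℕ.+ p ℕ.* m′) ≈ bin x₀ m₀ * B x′ m′
  B-lucas {x₀} {m₀} x₀<p m₀<p = ℤ-induction (λ x′ → ∀ m′ → L x′ m′ ≈ bin x₀ m₀ * B x′ m′) base up down
    where
    L : ℤ → ℕ → ℤ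
    L x′ m′ = B (+ x₀ + + p * x′) (m₀ ℕ.+ p ℕ.* m′)
    shift : ∀ p x₀ x′ → x₀ + p * (1ℤ + x′) ≡ p + (x₀ + p * x′)
    shift = solve-∀
    shift-ℕ : ∀ m′ → m₀ ℕ.+ p ℕ.* suc m′ ≡ p ℕ.+ (m₀ ℕ.+ p ℕ.* m′)
    shift-ℕ = lem p m₀
      where
      lem : ∀ p m₀ m′ → m₀ ℕ.+ p ℕ.* suc m′ ≡ p ℕ.+ (m₀ ℕ.+ p ℕ.* m′)
      lem = ℕ-Ring.solve-∀
    m₀+p*0 : m₀ ℕ.+ p ℕ.* 0 ≡ m₀
    m₀+p*0 = trans (cong (ℕ._+_ m₀) (ℕ.*-zeroʳ p)) (ℕ.+-identityʳ m₀)
    x₀+p*0 : + x₀ + + p * 0ℤ ≡ + x₀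
    x₀+p*0 = trans (cong (_+_ (+ x₀)) (ℤ.*-zeroʳ (+ p))) (ℤ.+-identityʳ (+ x₀))
    L-zero : ∀ x′ → L (1ℤ + x′) 0 ≈ L x′ 0
    L-zero x′ = ≈-trans (≈-reflexive (cong (λ y → B y (m₀ ℕ.+ p ℕ.* 0)) (shift (+ p) (+ x₀) x′)))
                        (B-period (subst (_< p) (sym m₀+p*0) m₀<p) (+ x₀ + + p * x′))
    L-suc : ∀ x′ m′ → L (1ℤ + x′) (suc m′) ≈ L x′ m′ + L x′ (suc m′)
    L-suc x′ m′ = begin
      L (1ℤ + x′) (suc m′)                                          ≡⟨ cong₂ B (shift (+ p) (+ x₀) x′) (shift-ℕ m′) ⟩
      B (+ p + (+ x₀ + + p * x′)) (p ℕ.+ (m₀ ℕ.+ p ℕ.* m′))        ≈⟨ B-shift (+ x₀ + + p * x′) (m₀ ℕ.+ p ℕ.* m′) ⟩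
      L x′ m′ + B (+ x₀ + + p * x′) (p ℕ.+ (m₀ ℕ.+ p ℕ.* m′))      ≡⟨ cong (λ n → L x′ m′ + B (+ x₀ + + p * x′) n) (shift-ℕ m′) ⟨
      L x′ m′ + L x′ (suc m′)                                       ∎
    base : ∀ m′ → L 0ℤ m′ ≈ bin x₀ m₀ * B 0ℤ m′
    base zero     = ≈-reflexive (trans (cong₂ B x₀+p*0 m₀+p*0) (sym (ℤ.*-identityʳ (bin x₀ m₀))))
    base (suc m′) = ≈-reflexive (trans (cong₂ B x₀+p*0 (shift-ℕ m′))
      (trans (bin-zero (ℕ.<-≤-trans x₀<p (ℕ.m≤m+n p _))) (sym (ℤ.*-zeroʳ (bin x₀ m₀)))))
    up : ∀ x′ → (∀ m′ → L x′ m′ ≈ bin x₀ m₀ * B x′ m′) → ∀ m′ → L (1ℤ + x′) m′ ≈ bin x₀ m₀ * B (1ℤ + x′) m′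
    up x′ ih zero     = ≈-trans (L-zero x′) (≈-trans (ih 0) (≈-reflexive (cong (_*_ (bin x₀ m₀)) (trans (B-0 x′) (sym (B-0 (1ℤ + x′)))))))
    up x′ ih (suc m′) = begin
      L (1ℤ + x′) (suc m′)                                  ≈⟨ L-suc x′ m′ ⟩
      L x′ m′ + L x′ (suc m′)                               ≈⟨ +-cong (ih m′) (ih (suc m′)) ⟩
      bin x₀ m₀ * B x′ m′ + bin x₀ m₀ * B x′ (suc m′)       ≡⟨ ℤ.*-distribˡ-+ (bin x₀ m₀) _ _ ⟨
      bin x₀ m₀ * (B x′ m′ + B x′ (suc m′))                 ≡⟨ cong (_*_ (bin x₀ m₀)) (B-pascal x′ m′) ⟨
      bin x₀ m₀ * B (1ℤ + x′) (suc m′)                      ∎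
    down : ∀ x′ → (∀ m′ → L (1ℤ + x′) m′ ≈ bin x₀ m₀ * B (1ℤ + x′) m′) → ∀ m′ → L x′ m′ ≈ bin x₀ m₀ * B x′ m′
    down x′ ih zero     = ≈-trans (≈-sym (L-zero x′)) (≈-trans (ih 0) (≈-reflexive (cong (_*_ (bin x₀ m₀)) (trans (B-0 (1ℤ + x′)) (sym (B-0 x′))))))
    down x′ ih (suc m′) = begin
      L x′ (suc m′)                                         ≡⟨ lem (L x′ m′) (L x′ (suc m′)) ⟩
      L x′ m′ + L x′ (suc m′) - L x′ m′                     ≈⟨ +-cong (≈-trans (≈-sym (L-suc x′ m′)) (ih (suc m′))) (neg-cong (down x′ ih m′)) ⟩
      bin x₀ m₀ * B (1ℤ + x′) (suc m′) - bin x₀ m₀ * B x′ m′ ≡⟨ cong (λ u → bin x₀ m₀ * u - bin x₀ m₀ * B x′ m′) (B-pascal x′ m′) ⟩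
      bin x₀ m₀ * (B x′ m′ + B x′ (suc m′)) - bin x₀ m₀ * B x′ m′ ≡⟨ lem′ (bin x₀ m₀) (B x′ m′) (B x′ (suc m′)) ⟩
      bin x₀ m₀ * B x′ (suc m′)                             ∎
      where
      lem : ∀ u v → v ≡ u + v - u
      lem = solve-∀
      lem′ : ∀ w u v → w * (u + v) - w * u ≡ w * v
      lem′ = solve-∀

  -- The hypothesis s < p + m covers the case of a carry: both sides then vanish.
  bin-lucas : ∀ {s m} → m < p → s < p ℕ.+ m → ∀ s′ m′ → bin (s ℕ.+ p ℕ.* s′) (m ℕ.+ p ℕ.* m′) ≈ bin s m * bin s′ m′
  bin-lucas {s} {m} m<p s<p+m s′ m′ with ℕ.<-≤-connex s p
  ... | inj₁ s<p = ≈-trans (≈-reflexive (cong (λ x → B x (m ℕ.+ p ℕ.* m′)) (trans (ℤ.pos-+ s _) (cong (_+_ (+ s)) (ℤ.pos-* p s′)))))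
                           (B-lucas s<p m<p (+ s′) m′)
  ... | inj₂ p≤s = begin
    bin (s ℕ.+ p ℕ.* s′) (m ℕ.+ p ℕ.* m′)  ≈⟨ carry s′ m′ ⟩
    0ℤ                                     ≡⟨⟩
    0ℤ * bin s′ m′                         ≈⟨ *-cong (carry 0 0) ≈-refl ⟨
    bin (s ℕ.+ p ℕ.* 0) (m ℕ.+ p ℕ.* 0) * bin s′ m′ ≡⟨ cong₂ (λ i j → bin i j * bin s′ m′) (+p*0 s) (+p*0 m) ⟩
    bin s m * bin s′ m′                    ∎
    where
    t = s ∸ p
    t<m : t < m
    t<m = ℕ.+-cancelˡ-< p t m (subst (_< p ℕ.+ m) (sym (ℕ.m+[n∸m]≡n p≤s)) s<p+m)
    +p*0 : ∀ i → i ℕ.+ p ℕ.* 0 ≡ i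
    +p*0 i = trans (cong (ℕ._+_ i) (ℕ.*-zeroʳ p)) (ℕ.+-identityʳ i)
    split : ∀ s′ → + (s ℕ.+ p ℕ.* s′) ≡ + t + + p * + suc s′
    split s′ = trans (cong +_ (trans (cong (ℕ._+ p ℕ.* s′) (sym (ℕ.m+[n∸m]≡n p≤s))) (lem p t s′)))
                     (trans (ℤ.pos-+ t _) (cong (_+_ (+ t)) (ℤ.pos-* p (suc s′))))
      where
      lem : ∀ p t s′ → p ℕ.+ t ℕ.+ p ℕ.* s′ ≡ t ℕ.+ p ℕ.* suc s′
      lem = ℕ-Ring.solve-∀
    carry : ∀ s′ m′ → bin (s ℕ.+ p ℕ.* s′) (m ℕ.+ p ℕ.* m′) ≈ 0ℤ
    carry s′ m′ = begin
      bin (s ℕ.+ p ℕ.* s′) (m ℕ.+ p ℕ.* m′)        ≡⟨ cong (λ x → B x (m ℕ.+ p ℕ.* m′)) (split s′) ⟩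
      B (+ t + + p * + suc s′) (m ℕ.+ p ℕ.* m′)    ≈⟨ B-lucas (ℕ.<-trans t<m m<p) m<p (+ suc s′) m′ ⟩
      bin t m * bin (suc s′) m′                    ≡⟨ cong (_* bin (suc s′) m′) (bin-zero t<m) ⟩
      0ℤ                                           ∎

  -- Deg d f: modulo p, f is a polynomial function of degree less than d.
  Deg : ℕ → (ℕ → ℤ) → Set
  Deg zero    f = ∀ k → f k ≈ 0ℤ
  Deg (suc d) f = Deg d (Δ f)

  Deg-cong : ∀ d {f g} → (∀ k → f k ≈ g k) → Deg d f → Deg d g
  Deg-cong zero    e df k = ≈-trans (≈-sym (e k)) (df k)
  Deg-cong (suc d) e df   = Deg-cong d (λ k → +-cong (e (suc k)) (neg-cong (e k))) df

  Deg-zero : ∀ d {f} → (∀ k → f k ≈ 0ℤ) → Deg d f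
  Deg-zero zero    e = e
  Deg-zero (suc d) e = Deg-zero d (λ k → +-cong (e (suc k)) (neg-cong (e k)))

  Deg-suc : ∀ d {f} → Deg d f → Deg (suc d) f
  Deg-suc zero    df = Deg-zero 1 df
  Deg-suc (suc d) df = Deg-suc d df

  Deg-+ : ∀ d {f g} → Deg d f → Deg d g → Deg d (λ k → f k + g k)
  Deg-+ zero    df dg k = +-cong (df k) (dg k)
  Deg-+ (suc d) {f} {g} df dg = Deg-cong d (λ k → ≈-reflexive (lem (f k) (f (suc k)) (g k) (g (suc k)))) (Deg-+ d df dg)
    where
    lem : ∀ f f′ g g′ → (f′ - f) + (g′ - g) ≡ f′ + g′ - (f + g)
    lem = solve-∀

  Deg-neg : ∀ d {f} → Deg d f → Deg d (λ k → - f k)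
  Deg-neg zero    df k = neg-cong (df k)
  Deg-neg (suc d) {f} df = Deg-cong d (λ k → ≈-reflexive (lem (f k) (f (suc k)))) (Deg-neg d df)
    where
    lem : ∀ f f′ → - (f′ - f) ≡ - f′ - - f
    lem = solve-∀

  Deg-shift : ∀ d {f} → Deg d f → Deg d (λ k → f (suc k))
  Deg-shift zero    df k = df (suc k)
  Deg-shift (suc d) df = Deg-shift d df

  -- The discrete Leibniz rule Δ(fg)(k) = Δf(k) g(k+1) + f(k) Δg(k), with induction on both degrees.
  -- As `Deg` bounds strictly, `suc d` and `suc e` stand for degrees at most d and e.
  Deg-* : ∀ d e {f g} → Deg (suc d) f → Deg (suc e) g → Deg (suc (d ℕ.+ e)) (λ k → f k * g k)
  Deg-* d e {f} {g} df dg = Deg-cong (d ℕ.+ e) (λ k → ≈-reflexive (lem (f k) (f (suc k)) (g k) (g (suc k))))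
    (Deg-+ (d ℕ.+ e) (first d df) (second e dg))
    where
    lem : ∀ f f′ g g′ → (f′ - f) * g′ + f * (g′ - g) ≡ f′ * g′ - f * g
    lem = solve-∀
    first : ∀ d → Deg (suc d) f → Deg (d ℕ.+ e) (λ k → Δ f k * g (suc k))
    first zero    df = Deg-zero e (λ k → *-zeroˡ (g (suc k)) (df k))
    first (suc d) df = Deg-* d e {Δ f} {λ k → g (suc k)} df (Deg-shift (suc e) {g} dg)
    second : ∀ e → Deg (suc e) g → Deg (d ℕ.+ e) (λ k → f k * Δ g k)
    second zero    dg = Deg-zero (d ℕ.+ 0) (λ k → *-zeroʳ (f k) (dg k))
    second (suc e) dg = subst (λ n → Deg n (λ k → f k * Δ g k)) (sym (ℕ.+-suc d e)) (Deg-* d e {f} {Δ g} df dg)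

  Deg⇒Δ^≈0 : ∀ d {f} → Deg d f → ∀ k → Δ^ d f k ≈ 0ℤ
  Deg⇒Δ^≈0 zero    df = df
  Deg⇒Δ^≈0 (suc d) df = Deg⇒Δ^≈0 d df

  -- The partial sums F satisfy ΔF = f, so F has degree less than p. The freshman's dream for 1 + Δ
  -- gives F(p) ≈ F(0) + Δ^p F(0), and both terms vanish.
  sum-polynomial : ∀ {f d} → suc d ≡ p → Deg d f → sumlt p f ≈ 0ℤ
  sum-polynomial {f} {d} refl df = begin
    sumlt p f                       ≈⟨ pascal-array-p (λ i j → Δ^ j F i) (λ i j → Δ^-step F i j) 0 ⟩
    0ℤ + Δ^ p F 0                   ≈⟨ +-cong (≈-refl {0ℤ}) (Deg⇒Δ^≈0 p {F} (Deg-cong d (λ k → ≈-reflexive (lem (F k) (f k))) df) 0) ⟩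
    0ℤ                              ∎
    where
    F : ℕ → ℤ
    F k = sumlt k f
    lem : ∀ u v → v ≡ u + v - u
    lem = solve-∀

  -- Lucas congruences for sequences and summands

  record LucasSeq (C : ℕ → ℤ) : Set where
    constructor lucas-seq
    field at-digits : ∀ {n₀} → n₀ < p → ∀ n′ → C (n₀ ℕ.+ p ℕ.* n′) ≈ C n₀ * C n′
  open LucasSeq public

  record LucasTerm (F : ℕ → ℕ → ℤ) : Set where
    constructor lucas-term
    field at-digits : ∀ {n₀ k₀} → n₀ < p → k₀ < p → ∀ n′ k′ → F (n₀ ℕ.+ p ℕ.* n′) (k₀ ℕ.+ p ℕ.* k′) ≈ F n₀ k₀ * F n′ k′
  open LucasTerm public renaming (at-digits to at-digits²)

  -- Only digits with k₀ ≤ n₀ and k′ ≤ n′ are considered. There n - k has no borrow, and factors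
  -- such as C(n+k,n) or C(2k,n) meet the bound in `bin-lucas`.
  record LucasBelow (F : ℕ → ℕ → ℤ) : Set where
    constructor lucas-below
    field at-digits : ∀ {n₀ k₀} → n₀ < p → k₀ ≤ n₀ → ∀ {n′ k′} → k′ ≤ n′ →
                      F (n₀ ℕ.+ p ℕ.* n′) (k₀ ℕ.+ p ℕ.* k′) ≈ F n₀ k₀ * F n′ k′
  open LucasBelow public renaming (at-digits to at-digits-below)

  term⇒below : ∀ {F} → LucasTerm F → LucasBelow F
  term⇒below (lucas-term F-lucas) = lucas-below λ n₀<p k₀≤n₀ {n′} {k′} _ → F-lucas n₀<p (ℕ.≤-<-trans k₀≤n₀ n₀<p) n′ k′

  interchange : ∀ {x y} x₀ x′ y₀ y′ → x ≈ x₀ * x′ → y ≈ y₀ * y′ → x * y ≈ (x₀ * y₀) * (x′ * y′)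
  interchange x₀ x′ y₀ y′ ex ey = ≈-trans (*-cong ex ey) (≈-reflexive (lem x₀ x′ y₀ y′))
    where
    lem : ∀ u v w z → u * v * (w * z) ≡ u * w * (v * z)
    lem = solve-∀

  infixl 7 _⊛_
  _⊛_ : ∀ {F G} → LucasBelow F → LucasBelow G → LucasBelow (λ n k → F n k * G n k)
  _⊛_ {F} {G} F-lucas G-lucas = lucas-below λ {n₀} {k₀} n₀<p k₀≤n₀ {n′} {k′} k′≤n′ →
    interchange (F n₀ k₀) (F n′ k′) (G n₀ k₀) (G n′ k′) (at-digits-below F-lucas n₀<p k₀≤n₀ k′≤n′) (at-digits-below G-lucas n₀<p k₀≤n₀ k′≤n′)

  infixl 8 _⊛^_
  _⊛^_ : ∀ {F} → LucasBelow F → ∀ m → LucasBelow (λ n k → F n k ^ m)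
  F-lucas ⊛^ zero  = lucas-below λ _ _ _ → ≈-refl
  F-lucas ⊛^ suc m = F-lucas ⊛ F-lucas ⊛^ m

  lower : ∀ {C} → LucasSeq C → LucasBelow (λ n k → C k)
  lower (lucas-seq C-lucas) = lucas-below λ n₀<p k₀≤n₀ {_} {k′} _ → C-lucas (ℕ.≤-<-trans k₀≤n₀ n₀<p) k′

  at-difference : ∀ {F} → LucasTerm F → LucasBelow (λ n k → F (n ∸ k) k)
  at-difference {F} (lucas-term F-lucas) = lucas-below λ {n₀} {k₀} n₀<p k₀≤n₀ {n′} {k′} k′≤n′ →
    ≈-trans (≈-reflexive (cong (λ i → F i (k₀ ℕ.+ p ℕ.* k′)) (∸-digits p k₀≤n₀ k′≤n′)))
            (F-lucas (ℕ.≤-<-trans (ℕ.m∸n≤m n₀ k₀) n₀<p) (ℕ.≤-<-trans k₀≤n₀ n₀<p) (n′ ∸ k′) k′)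

  difference : ∀ {C} → LucasSeq C → LucasBelow (λ n k → C (n ∸ k))
  difference {C} (lucas-seq C-lucas) = at-difference {λ n _ → C n} (lucas-term λ n₀<p _ n′ _ → C-lucas n₀<p n′)

  bin-term : LucasTerm bin
  bin-term = lucas-term λ {_} {k₀} n₀<p k₀<p n′ k′ → bin-lucas k₀<p (ℕ.<-≤-trans n₀<p (ℕ.m≤m+n p k₀)) n′ k′

  bin-below : LucasBelow bin
  bin-below = term⇒below bin-term

  supported-≈0 : ∀ {x y} → x ∣ y → x ≈ 0ℤ → y ≈ 0ℤ
  supported-≈0 (divides q eq) e = ≈-trans (≈-reflexive eq) (*-zeroʳ q e)

  -- If k₀ > n₀ or k′ > n′, Lucas' theorem gives C(n,k) ≈ 0, so the left side vanishes modulo p by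
  -- support. On the right one factor is exactly zero.
  below⇒term : ∀ {F} → Supported F → LucasBelow F → LucasTerm F
  below⇒term {F} sup (lucas-below F-lucas) = lucas-term go
    where
    go : ∀ {n₀ k₀} → n₀ < p → k₀ < p → ∀ n′ k′ → F (n₀ ℕ.+ p ℕ.* n′) (k₀ ℕ.+ p ℕ.* k′) ≈ F n₀ k₀ * F n′ k′
    go {n₀} {k₀} n₀<p k₀<p n′ k′ with k₀ ℕ.≤? n₀ | k′ ℕ.≤? n′
    ... | yes k₀≤n₀ | yes k′≤n′ = F-lucas n₀<p k₀≤n₀ k′≤n′
    ... | no k₀≰n₀ | _ = ≈-trans
      (supported-≈0 (sup _ _) (≈-trans (at-digits² bin-term n₀<p k₀<p n′ k′) (*-zeroˡ (bin n′ k′) (≈-reflexive (bin-zero (ℕ.≰⇒> k₀≰n₀))))))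
      (≈-sym (*-zeroˡ (F n′ k′) (≈-reflexive (supported-zero sup (ℕ.≰⇒> k₀≰n₀)))))
    ... | _ | no k′≰n′ = ≈-trans
      (supported-≈0 (sup _ _) (≈-trans (at-digits² bin-term n₀<p k₀<p n′ k′) (*-zeroʳ (bin n₀ k₀) (≈-reflexive (bin-zero (ℕ.≰⇒> k′≰n′))))))
      (≈-sym (*-zeroʳ (F n₀ k₀) (≈-reflexive (supported-zero sup (ℕ.≰⇒> k′≰n′)))))

  -- The range is enlarged by zero terms to length p(n′+1), which consists of complete blocks.
  sum-digits : ∀ {n₀} → n₀ < p → ∀ n′ G → (∀ k → n₀ ℕ.+ p ℕ.* n′ < k → G k ≡ 0ℤ) →
               sumTo (n₀ ℕ.+ p ℕ.* n′) G ≡ sumlt (suc n′) (λ k′ → sumlt p (λ k₀ → G (k₀ ℕ.+ p ℕ.* k′)))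
  sum-digits {n₀} n₀<p n′ G vanish =
    trans (sumTo≡sumlt (n₀ ℕ.+ p ℕ.* n′) G)
    (trans (sym (sumlt-extend G (digits-< n₀<p n′) vanish)) (sumlt-blocks p (suc n′) G))

  -- The double sum over digits factors. The three summands are separate arguments so that they may
  -- depend on further parameters, as in the inner sum of (ζ).
  sum-lucas : ∀ {n₀} → n₀ < p → ∀ n′ (G G₀ G′ : ℕ → ℤ) →
              (∀ k → n₀ ℕ.+ p ℕ.* n′ < k → G k ≡ 0ℤ) → (∀ k → n₀ < k → G₀ k ≡ 0ℤ) →
              (∀ {k₀} → k₀ < p → ∀ k′ → G (k₀ ℕ.+ p ℕ.* k′) ≈ G₀ k₀ * G′ k′) →
              sumTo (n₀ ℕ.+ p ℕ.* n′) G ≈ sumTo n₀ G₀ * sumTo n′ G′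
  sum-lucas {n₀} n₀<p n′ G G₀ G′ vanish vanish₀ step = begin
    sumTo (n₀ ℕ.+ p ℕ.* n′) G                                              ≡⟨ sum-digits n₀<p n′ G vanish ⟩
    sumlt (suc n′) (λ k′ → sumlt p (λ k₀ → G (k₀ ℕ.+ p ℕ.* k′)))           ≈⟨ sum-cong (suc n′) (λ k′ _ → sum-cong p (λ k₀ k₀<p → step k₀<p k′)) ⟩
    sumlt (suc n′) (λ k′ → sumlt p (λ k₀ → G₀ k₀ * G′ k′))                 ≡⟨ sumlt-cong (suc n′) (λ k′ _ → sumlt-*ʳ p (G′ k′) G₀) ⟩
    sumlt (suc n′) (λ k′ → sumlt p G₀ * G′ k′)                             ≡⟨ sumlt-*ˡ (suc n′) (sumlt p G₀) G′ ⟩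
    sumlt p G₀ * sumlt (suc n′) G′                                         ≡⟨ cong₂ _*_ (sumlt-extend G₀ n₀<p vanish₀) (sym (sumTo≡sumlt n′ G′)) ⟩
    sumlt (suc n₀) G₀ * sumTo n′ G′                                        ≡⟨ cong (_* sumTo n′ G′) (sumTo≡sumlt n₀ G₀) ⟨
    sumTo n₀ G₀ * sumTo n′ G′                                              ∎

  sum-term : ∀ {F} → Supported F → LucasTerm F → LucasSeq (λ n → sumTo n (F n))
  sum-term {F} sup (lucas-term F-lucas) = lucas-seq λ {n₀} n₀<p n′ →
    sum-lucas n₀<p n′ (F (n₀ ℕ.+ p ℕ.* n′)) (F n₀) (F n′) (λ _ → supported-zero sup) (λ _ → supported-zero sup)
              (λ k₀<p k′ → F-lucas n₀<p k₀<p n′ k′)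

  sum-below : ∀ {F} → Supported F → LucasBelow F → LucasSeq (λ n → sumTo n (F n))
  sum-below sup F-lucas = sum-term sup (below⇒term sup F-lucas)

  LucasSeq-resp : ∀ {C D : ℕ → ℤ} → (∀ n → C n ≡ D n) → LucasSeq D → LucasSeq C
  LucasSeq-resp eq (lucas-seq D-lucas) = lucas-seq λ {n₀} n₀<p n′ → ≈-trans (≈-reflexive (eq _)) (≈-trans (D-lucas n₀<p n′) (≈-reflexive (sym (cong₂ _*_ (eq n₀) (eq n′)))))

  sgn-lucas : LucasSeq sgn
  sgn-lucas = lucas-seq λ {n₀} _ → ^-lucas -1ℤ n₀

  power-lucas : ∀ m → LucasSeq (λ n → + (m ℕ.^ n))
  power-lucas m = LucasSeq-resp (pos-^ m) (lucas-seq λ {n₀} _ → ^-lucas (+ m) n₀)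

  -- The doubled digit 2k₀ may reach p, but 2k₀ < p + k₀ always holds, which is the bound that
  -- `bin-lucas` asks for.
  central-lucas : LucasSeq (λ k → bin (2 ℕ.* k) k)
  central-lucas = lucas-seq λ {k₀} k₀<p k′ → ≈-trans (≈-reflexive (cong (λ i → bin i (k₀ ℕ.+ p ℕ.* k′)) (*-digits 2 p k₀ k′)))
    (bin-lucas k₀<p (2*k<p+n k₀<p ℕ.≤-refl) (2 ℕ.* k′) k′)

  bin[2k,n] : LucasBelow (λ n k → bin (2 ℕ.* k) n)
  bin[2k,n] = lucas-below λ {n₀} {k₀} n₀<p k₀≤n₀ {n′} {k′} _ →
    ≈-trans (≈-reflexive (cong (λ i → bin i (n₀ ℕ.+ p ℕ.* n′)) (*-digits 2 p k₀ k′)))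
            (bin-lucas n₀<p (2*k<p+n (ℕ.≤-<-trans k₀≤n₀ n₀<p) k₀≤n₀) (2 ℕ.* k′) n′)

  bin[n+k,n] : LucasBelow (λ n k → bin (n ℕ.+ k) n)
  bin[n+k,n] = lucas-below λ {n₀} {k₀} n₀<p k₀≤n₀ {n′} {k′} _ →
    ≈-trans (≈-reflexive (cong (λ i → bin i (n₀ ℕ.+ p ℕ.* n′)) (+-digits p n₀ n′ k₀ k′)))
            (bin-lucas n₀<p (subst (_< p ℕ.+ n₀) (ℕ.+-comm k₀ n₀) (ℕ.+-monoˡ-< n₀ (ℕ.≤-<-trans k₀≤n₀ n₀<p))) (n′ ℕ.+ k′) n′)

  bin[n+k,k] : LucasBelow (λ n k → bin (n ℕ.+ k) k)
  bin[n+k,k] = lucas-below λ {n₀} {k₀} n₀<p k₀≤n₀ {n′} {k′} _ →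
    ≈-trans (≈-reflexive (cong (λ i → bin i (k₀ ℕ.+ p ℕ.* k′)) (+-digits p n₀ n′ k₀ k′)))
            (bin-lucas (ℕ.≤-<-trans k₀≤n₀ n₀<p) (ℕ.+-monoˡ-< k₀ n₀<p) (n′ ℕ.+ k′) k′)

  ζ-inner : ℕ → ℕ → ℤ
  ζ-inner n k = sumTo n (λ l → bin n l * bin k l * bin (k ℕ.+ l) n)

  -- The digit sum k₀ + l₀ stays below p + n₀ because k₀ ≤ n₀ and l₀ < p; this handles carries in
  -- C(k+l,n).
  ζ-inner-below : LucasBelow ζ-inner
  ζ-inner-below = lucas-below λ {n₀} {k₀} n₀<p k₀≤n₀ {n′} {k′} _ →
    sum-lucas n₀<p n′ (term (n₀ ℕ.+ p ℕ.* n′) (k₀ ℕ.+ p ℕ.* k′)) (term n₀ k₀) (term n′ k′) (λ _ → vanish (k₀ ℕ.+ p ℕ.* k′)) (λ _ → vanish k₀)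
      (λ {l₀} l₀<p l′ → interchange (bin n₀ l₀ * bin k₀ l₀) (bin n′ l′ * bin k′ l′) (bin (k₀ ℕ.+ l₀) n₀) (bin (k′ ℕ.+ l′) n′)
        (interchange (bin n₀ l₀) (bin n′ l′) (bin k₀ l₀) (bin k′ l′) (at-digits² bin-term n₀<p l₀<p n′ l′) (at-digits² bin-term (ℕ.≤-<-trans k₀≤n₀ n₀<p) l₀<p k′ l′))
        (≈-trans (≈-reflexive (cong (λ i → bin i (n₀ ℕ.+ p ℕ.* n′)) (+-digits p k₀ k′ l₀ l′)))
                 (bin-lucas n₀<p (subst (k₀ ℕ.+ l₀ <_) (ℕ.+-comm n₀ p) (ℕ.+-mono-≤-< k₀≤n₀ l₀<p)) (k′ ℕ.+ l′) n′)))
    where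
    term : ℕ → ℕ → ℕ → ℤ
    term n k l = bin n l * bin k l * bin (k ℕ.+ l) n
    vanish : ∀ {n l} k → n < l → term n k l ≡ 0ℤ
    vanish {n} {l} k n<l = cong (λ x → x * bin k l * bin (k ℕ.+ l) n) (bin-zero n<l)

  -- One layer of `f-term`: the leading C(n,k) supplies the support, and `H` receives the
  -- borrow-free difference n - k.
  nest : ∀ {H} → LucasTerm H → LucasTerm (λ n k → bin n k * H (n ∸ k) k)
  nest {H} H-lucas = below⇒term (λ n k → ∣m⇒∣m*n (H (n ∸ k) k) ∣-refl) (bin-below ⊛ at-difference H-lucas)

  f-term-lucas : LucasTerm f-term
  f-term-lucas = nest (nest (below⇒term (λ n k → ∣m⇒∣m*n (+ (3 ℕ.^ (n ∸ k))) ∣-refl) (bin-below ⊛ difference (power-lucas 3))))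

  -- Lucas congruences for the twisted sums

  module _
    {w : ℕ → ℕ → ℤ} (w-reflect : ∀ {n k} → k ≤ n → w n (n ∸ k) ≡ sgn n * w n k)
    (w-supported : Supported w) (w-lucas : LucasTerm w)
    {c : ℕ} (c≤3 : c ≤ 3) (c-odd : ∀ n → sgn (c ℕ.* n) ≡ sgn n)
    (defect-sum : ∀ {n₀ r} → n₀ < p → r < p → c ℕ.* n₀ ≡ r ℕ.+ p ℕ.* 2 → sumlt p (λ k → w n₀ k * B (entry c n₀ k) r) ≈ 0ℤ)
    where
    open Twisted w w-reflect c c-odd

    S-lucas : LucasSeq S
    S-lucas = lucas-seq go
      where
      S-sum : ∀ n → S n ≡ sumTo n (λ k → w n k * B (entry c n k) (c ℕ.* n))
      S-sum n = trans (sumlt-cong (suc n) (λ k _ → cong (w n k *_) (cong₂ B (ℤ.+-identityʳ (entry c n k)) (ℕ.+-identityʳ (c ℕ.* n)))))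
                      (sym (sumTo≡sumlt n _))
      go : ∀ {n₀} → n₀ < p → ∀ n′ → S (n₀ ℕ.+ p ℕ.* n′) ≈ S n₀ * S n′
      go {n₀} n₀<p n′ = begin
        S n
          ≡⟨ S-sum n ⟩
        sumTo n (λ k → w n k * B (entry c n k) (c ℕ.* n))
          ≡⟨ sum-digits n₀<p n′ _ (λ k n<k → cong (_* B (entry c n k) (c ℕ.* n)) (supported-zero w-supported n<k)) ⟩
        sumlt (suc n′) (λ k′ → sumlt p (λ k₀ → w n (k₀ ℕ.+ p ℕ.* k′) * B (entry c n (k₀ ℕ.+ p ℕ.* k′)) (c ℕ.* n)))
          -- Lucas' theorem splits off `bin (x₀ k₀) r`; the carries `e k₀` and `i` remain as shifts
          -- of the upper and lower entries.
          ≈⟨ sum-cong (suc n′) (λ k′ _ → sum-cong p (λ k₀ k₀<p → interchange (w n₀ k₀) (w n′ k′) (bin (x₀ k₀) r) _ (at-digits² w-lucas n₀<p k₀<p n′ k′) (B-digits k₀ k′))) ⟩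
        sumlt (suc n′) (λ k′ → sumlt p (λ k₀ → v k₀ * (w n′ k′ * B (entry c n′ k′ + e k₀) (c ℕ.* n′ ℕ.+ i))))
          ≡⟨ sumlt-swap (suc n′) p _ ⟩
        sumlt p (λ k₀ → sumlt (suc n′) (λ k′ → v k₀ * (w n′ k′ * B (entry c n′ k′ + e k₀) (c ℕ.* n′ ℕ.+ i))))
          ≡⟨ sumlt-cong p (λ k₀ _ → sumlt-*ˡ (suc n′) (v k₀) _) ⟩
        sumlt p (λ k₀ → v k₀ * U (e k₀) i n′)
          ≈⟨ sum-cong p (λ k₀ _ → inner k₀) ⟩
        sumlt p (λ k₀ → w n₀ k₀ * B (entry c n₀ k₀) (c ℕ.* n₀) * S n′ + w n₀ k₀ * B (entry c n₀ k₀) r * defect i n′)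
          ≡⟨ trans (sumlt-+ p _ _) (cong₂ _+_ (sumlt-*ʳ p (S n′) _) (sumlt-*ʳ p (defect i n′) _)) ⟩
        sumlt p (λ k₀ → w n₀ k₀ * B (entry c n₀ k₀) (c ℕ.* n₀)) * S n′ + sumlt p (λ k₀ → w n₀ k₀ * B (entry c n₀ k₀) r) * defect i n′
          ≈⟨ +-cong (≈-reflexive (cong (_* S n′) (trans (sumlt-extend _ n₀<p (λ k n₀<k → cong (_* B (entry c n₀ k) (c ℕ.* n₀)) (supported-zero w-supported n₀<k)))
                                                      (trans (sym (sumTo≡sumlt n₀ _)) (sym (S-sum n₀)))))) defect-vanishes ⟩
        S n₀ * S n′ + 0ℤ
          ≡⟨ ℤ.+-identityʳ _ ⟩
        S n₀ * S n′ ∎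
        where
        n = n₀ ℕ.+ p ℕ.* n′
        r = (c ℕ.* n₀) ℕ.% p
        i = (c ℕ.* n₀) ℕ./ p
        x₀ : ℕ → ℕ
        x₀ k₀ = entry c n₀ k₀ %ℕ p
        e : ℕ → ℤ
        e k₀ = entry c n₀ k₀ /ℕ p
        v : ℕ → ℤ
        v k₀ = w n₀ k₀ * bin (x₀ k₀) r
        r<p : r < p
        r<p = ℕ.m%n<n (c ℕ.* n₀) p
        x₀<p : ∀ k₀ → x₀ k₀ < p
        x₀<p k₀ = n%ℕd<d (entry c n₀ k₀) p
        cn₀≡ : c ℕ.* n₀ ≡ r ℕ.+ p ℕ.* i
        cn₀≡ = trans (ℕ.m≡m%n+[m/n]*n (c ℕ.* n₀) p) (cong (ℕ._+_ r) (ℕ.*-comm i p))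
        i<3 : i < 3
        i<3 = ℕ.m<n*o⇒m/o<n (ℕ.≤-<-trans (ℕ.*-monoˡ-≤ n₀ c≤3) (ℕ.*-monoʳ-< 3 n₀<p))
        entry≡ : ∀ k₀ → entry c n₀ k₀ ≡ + x₀ k₀ + + p * e k₀
        entry≡ k₀ = trans (a≡a%ℕn+[a/ℕn]*n (entry c n₀ k₀) p) (cong (_+_ (+ x₀ k₀)) (ℤ.*-comm (e k₀) (+ p)))
        cn≡ : c ℕ.* n ≡ r ℕ.+ p ℕ.* (c ℕ.* n′ ℕ.+ i)
        cn≡ = trans (*-digits c p n₀ n′) (trans (cong (ℕ._+ p ℕ.* (c ℕ.* n′)) cn₀≡) (lem r p i (c ℕ.* n′)))
          where
          lem : ∀ r p i m → r ℕ.+ p ℕ.* i ℕ.+ p ℕ.* m ≡ r ℕ.+ p ℕ.* (m ℕ.+ i)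
          lem = ℕ-Ring.solve-∀
        B-digits : ∀ k₀ k′ → B (entry c n (k₀ ℕ.+ p ℕ.* k′)) (c ℕ.* n) ≈ bin (x₀ k₀) r * B (entry c n′ k′ + e k₀) (c ℕ.* n′ ℕ.+ i)
        B-digits k₀ k′ = ≈-trans (≈-reflexive (cong₂ B
            (trans (entry-digits c p n₀ n′ k₀ k′) (trans (cong (_+ + p * entry c n′ k′) (entry≡ k₀)) (lem (+ x₀ k₀) (+ p) (e k₀) (entry c n′ k′)))) cn≡))
            (B-lucas (x₀<p k₀) r<p (entry c n′ k′ + e k₀) (c ℕ.* n′ ℕ.+ i))
          where
          lem : ∀ x p e m → x + p * e + p * m ≡ x + p * (m + e)
          lem = solve-∀
        B-main : ∀ k₀ → B (entry c n₀ k₀) (c ℕ.* n₀) ≈ bin (x₀ k₀) r * B (e k₀) i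
        B-main k₀ = ≈-trans (≈-reflexive (cong₂ B (entry≡ k₀) cn₀≡)) (B-lucas (x₀<p k₀) r<p (e k₀) i)
        B-rest : ∀ k₀ → B (entry c n₀ k₀) r ≈ bin (x₀ k₀) r
        B-rest k₀ = ≈-trans (≈-reflexive (cong (λ x → B x r) (entry≡ k₀))) (B-period-* r<p (e k₀) (+ x₀ k₀))
        -- If k₀ > n₀ or r > x₀, the coefficient `v k₀` is exactly zero. Otherwise `entry-quotient`
        -- puts `e k₀` in the range of `U-eval`.
        value : ∀ k₀ → v k₀ * U (e k₀) i n′ ≡ v k₀ * (B (e k₀) i * S n′ + defect i n′)
        value k₀ with k₀ ℕ.≤? n₀ | r ℕ.≤? x₀ k₀
        ... | yes k₀≤n₀ | yes r≤x₀ = cong (v k₀ *_) (U-eval (e k₀) i n′ i<3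
                  (entry-quotient n₀<p k₀≤n₀ (x₀<p k₀) r≤x₀ cn₀≡ (a≡a%ℕn+[a/ℕn]*n (entry c n₀ k₀) p)))
        ... | no k₀≰n₀ | _ = trans (cong (_* U (e k₀) i n′) v≡0) (cong (_* (B (e k₀) i * S n′ + defect i n′)) (sym v≡0))
          where
          v≡0 : v k₀ ≡ 0ℤ
          v≡0 = cong (_* bin (x₀ k₀) r) (supported-zero w-supported (ℕ.≰⇒> k₀≰n₀))
        ... | _ | no r≰x₀ = trans (cong (_* U (e k₀) i n′) v≡0) (cong (_* (B (e k₀) i * S n′ + defect i n′)) (sym v≡0))
          where
          v≡0 : v k₀ ≡ 0ℤ
          v≡0 = trans (cong (w n₀ k₀ *_) (bin-zero (ℕ.≰⇒> r≰x₀))) (ℤ.*-zeroʳ (w n₀ k₀))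
        -- Lucas' theorem read backwards restores the k₀-th summand of S(n₀) in the main term. In
        -- the error term, periodicity replaces `bin (x₀ k₀) r` by a coefficient with the full
        -- entry, so that `defect-sum` applies.
        inner : ∀ k₀ → v k₀ * U (e k₀) i n′ ≈ w n₀ k₀ * B (entry c n₀ k₀) (c ℕ.* n₀) * S n′ + w n₀ k₀ * B (entry c n₀ k₀) r * defect i n′
        inner k₀ = begin
          v k₀ * U (e k₀) i n′ ≡⟨ value k₀ ⟩
          v k₀ * (B (e k₀) i * S n′ + defect i n′) ≡⟨ lem (w n₀ k₀) (bin (x₀ k₀) r) (B (e k₀) i) (S n′) (defect i n′) ⟩
          w n₀ k₀ * (bin (x₀ k₀) r * B (e k₀) i) * S n′ + w n₀ k₀ * bin (x₀ k₀) r * defect i n′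
            ≈⟨ +-cong (*-cong (*-cong (≈-refl {w n₀ k₀}) (B-main k₀)) (≈-refl {S n′})) (*-cong (*-cong (≈-refl {w n₀ k₀}) (B-rest k₀)) (≈-refl {defect i n′})) ⟨
          w n₀ k₀ * B (entry c n₀ k₀) (c ℕ.* n₀) * S n′ + w n₀ k₀ * B (entry c n₀ k₀) r * defect i n′ ∎
          where
          lem : ∀ w x y s d → w * x * (y * s + d) ≡ w * (x * y) * s + w * x * d
          lem = solve-∀
        T : ℤ
        T = sumlt p (λ k₀ → w n₀ k₀ * B (entry c n₀ k₀) r)
        defect-vanishes : T * defect i n′ ≈ 0ℤ
        defect-vanishes with i | cn₀≡
        ... | 0 | _ = ≈-reflexive (ℤ.*-zeroʳ T)
        ... | 1 | _ = ≈-reflexive (ℤ.*-zeroʳ T)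
        ... | 2 | eq = *-zeroˡ (U 0ℤ 2 n′) (defect-sum n₀<p r<p eq)
        ... | suc (suc (suc _)) | _ = ≈-reflexive (ℤ.*-zeroʳ T)

    twisted-lucas : LucasSeq (λ n → sumTo n (λ k → w n k * binomℤ (+ (suc c ℕ.* n) - + (suc (suc c) ℕ.* k)) (c ℕ.* n)))
    twisted-lucas = LucasSeq-resp (λ n → trans (sumTo≡sumlt n _) (sumlt-cong (suc n) (λ k _ → cong (w n k *_)
      (trans (binomℤ≡B _ (c ℕ.* n)) (cong₂ B (trans (entry-pos c n k) (sym (ℤ.+-identityʳ (entry c n k)))) (sym (ℕ.+-identityʳ (c ℕ.* n)))))))) S-lucas

  -- Vanishing of the error for (η)

  -- The difference in `k` raises the upper entry by `a`. Integer induction on b, from 0 to a,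
  -- writes it as a signed sum of coefficients with lower entry one less, whose degrees are known.
  Deg-B : ∀ r a y → Deg (suc r) (λ k → B (y + a * + k) r)
  Deg-B zero    a y k = ≈-reflexive (cong₂ _-_ (B-0 (y + a * + suc k)) (B-0 (y + a * + k)))
  Deg-B (suc r) a y = Deg-cong (suc r) (λ k → ≈-reflexive (cong (λ x → B x (suc r) - B (y + a * + k) (suc r)) (lem a y (+ k))))
                                       (difference-Deg a)
    where
    lem : ∀ a y k → a + (y + a * k) ≡ y + a * (1ℤ + k)
    lem = solve-∀
    shifted : ∀ b → Deg (suc r) (λ k → B (b + (y + a * + k)) r)
    shifted b = Deg-cong (suc r) (λ k → ≈-reflexive (cong (λ x → B x r) (ℤ.+-assoc b y (a * + k)))) (Deg-B r a (b + y))
    pascal : ∀ b k → B (1ℤ + b + (y + a * + k)) (suc r) ≡ B (b + (y + a * + k)) r + B (b + (y + a * + k)) (suc r)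
    pascal b k = trans (cong (λ x → B x (suc r)) (ℤ.+-assoc 1ℤ b (y + a * + k))) (B-pascal (b + (y + a * + k)) r)
    D : ℤ → ℕ → ℤ
    D b k = B (b + (y + a * + k)) (suc r) - B (y + a * + k) (suc r)
    difference-Deg : ∀ b → Deg (suc r) (D b)
    difference-Deg = ℤ-induction (λ b → Deg (suc r) (D b))
      (Deg-zero (suc r) {D 0ℤ} (λ k → ≈-reflexive (ℤ.i≡j⇒i-j≡0 (cong (λ x → B x (suc r)) (ℤ.+-identityˡ (y + a * + k))))))
      (λ b ih → Deg-cong (suc r) {λ k → B (b + (y + a * + k)) r + D b k} {D (1ℤ + b)}
        (λ k → ≈-reflexive (sym (trans (cong (_- B (y + a * + k) (suc r)) (pascal b k)) (ℤ.+-assoc (B (b + (y + a * + k)) r) _ _))))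
        (Deg-+ (suc r) {λ k → B (b + (y + a * + k)) r} {D b} (shifted b) ih))
      (λ b ih → Deg-cong (suc r) {λ k → D (1ℤ + b) k + - B (b + (y + a * + k)) r} {D b}
        (λ k → ≈-reflexive (trans (cong (λ x → x - B (y + a * + k) (suc r) - B (b + (y + a * + k)) r) (pascal b k)) (lem′ (B (b + (y + a * + k)) r) _ (B (y + a * + k) (suc r)))))
        (Deg-+ (suc r) {D (1ℤ + b)} {λ k → - B (b + (y + a * + k)) r} ih (Deg-neg (suc r) {λ k → B (b + (y + a * + k)) r} (shifted b))))
      where
      lem′ : ∀ u v x → u + v - x - u ≡ v - x
      lem′ = solve-∀

  -- C(n,k) ≡ C(n-p,k) = (-1)^k C(m+k,m) with m = p-1-n.
  bin-complement : ∀ {n m k} → suc (m ℕ.+ n) ≡ p → k < p → bin n k ≈ sgn k * B (+ m + 1ℤ * + k) m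
  bin-complement {n} {m} {k} eq k<p = begin
    bin n k                        ≈⟨ B-period-* k<p -1ℤ (+ n) ⟨
    B (+ n + + p * -1ℤ) k          ≡⟨ cong (λ q → B (+ n + + q * -1ℤ) k) eq ⟨
    B (+ n + + suc (m ℕ.+ n) * -1ℤ) k ≡⟨ cong (λ x → B x k) (trans (cong (λ x → + n + (1ℤ + x) * -1ℤ) (ℤ.pos-+ m n)) (lem (+ n) (+ m))) ⟩
    sgn k * bin (m ℕ.+ k) k        ≡⟨ cong (sgn k *_) (trans (sym (bin-∸ (ℕ.m≤n+m k m))) (cong (bin (m ℕ.+ k)) (ℕ.m+n∸n≡m m k))) ⟩
    sgn k * bin (m ℕ.+ k) m        ≡⟨ cong (λ x → sgn k * B x m) (trans (ℤ.pos-+ m k) (cong (_+_ (+ m)) (sym (ℤ.*-identityˡ (+ k))))) ⟩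
    sgn k * B (+ m + 1ℤ * + k) m   ∎
    where
    lem : ∀ n m → n + (1ℤ + (m + n)) * -1ℤ ≡ - (1ℤ + m)
    lem = solve-∀

  -- By `bin-complement` each summand is a polynomial in `k` of degree at most 3m + r, where m =
  -- p-1-n. Since 3n = r + 2p, this equals p-3, and such a polynomial sums to zero over a full
  -- period.
  η-sum : ∀ {n r} → n < p → r < p → 3 ℕ.* n ≡ r ℕ.+ p ℕ.* 2 → sumlt p (λ k → η-weight n k * B (entry 3 n k) r) ≈ 0ℤ
  η-sum {n} {r} n<p _ 3n≡ = ≈-trans (sum-cong p step)
    (sum-polynomial {f = λ k → P k * (P k * P k) * Q k} degree
      -- The product has degree less than p-2, while `sum-polynomial` takes the bound p-1.
      (Deg-suc (suc (m ℕ.+ (m ℕ.+ m) ℕ.+ r)) {λ k → P k * (P k * P k) * Q k}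
        (Deg-* (m ℕ.+ (m ℕ.+ m)) r {λ k → P k * (P k * P k)} {Q}
          (Deg-* m (m ℕ.+ m) {P} {λ k → P k * P k} P-deg (Deg-* m m {P} {P} P-deg P-deg))
          (Deg-B r (- + 5) (+ 4 * + n)))))
    where
    m = p ∸ suc n
    p≡ : suc (m ℕ.+ n) ≡ p
    p≡ = trans (sym (ℕ.+-suc m n)) (ℕ.m∸n+n≡m n<p)
    P Q : ℕ → ℤ
    P k = B (+ m + 1ℤ * + k) m
    Q k = B (+ 4 * + n + - + 5 * + k) r
    P-deg : Deg (suc m) P
    P-deg = Deg-B m 1ℤ (+ m)
    degree : 3 ℕ.+ (m ℕ.+ (m ℕ.+ m) ℕ.+ r) ≡ p
    degree = ℕ.+-cancelʳ-≡ (p ℕ.* 2) _ p (trans (lem₁ m r p) (trans (cong (λ x → 3 ℕ.+ (m ℕ.+ (m ℕ.+ m)) ℕ.+ x) (sym 3n≡)) (trans (lem₂ m n) (trans (cong (3 ℕ.*_) p≡) (lem₃ p)))))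
      where
      lem₁ : ∀ m r p → 3 ℕ.+ (m ℕ.+ (m ℕ.+ m) ℕ.+ r) ℕ.+ p ℕ.* 2 ≡ 3 ℕ.+ (m ℕ.+ (m ℕ.+ m)) ℕ.+ (r ℕ.+ p ℕ.* 2)
      lem₁ = ℕ-Ring.solve-∀
      lem₂ : ∀ m n → 3 ℕ.+ (m ℕ.+ (m ℕ.+ m)) ℕ.+ 3 ℕ.* n ≡ 3 ℕ.* suc (m ℕ.+ n)
      lem₂ = ℕ-Ring.solve-∀
      lem₃ : ∀ p → 3 ℕ.* p ≡ p ℕ.+ p ℕ.* 2
      lem₃ = ℕ-Ring.solve-∀
    signs : ∀ s x → s * (s * x * (s * x * (s * x * 1ℤ))) ≡ s * s * (s * s) * (x * (x * x))
    signs = solve-∀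
    step : ∀ k → k < p → η-weight n k * B (entry 3 n k) r ≈ P k * (P k * P k) * Q k
    step k k<p = *-cong
      -- One sign comes from the weight and three from the cubed binomial; their product is 1,
      -- leaving a genuine polynomial.
      (≈-trans (*-cong (≈-refl {sgn k}) (^-cong 3 (bin-complement p≡ k<p)))
        (≈-reflexive (trans (signs (sgn k) (P k)) (trans (cong (λ t → t * t * (P k * (P k * P k))) (sgn² k)) (ℤ.*-identityˡ _)))))
      (≈-reflexive (cong (λ x → B x r) (lem (+ 4) (+ 5) (+ n) (+ k))))
      where
      lem : ∀ a b n k → a * n - b * k ≡ a * n + - b * k
      lem = solve-∀

  η-weight-supported : Supported η-weight
  η-weight-supported n k = ∣n⇒∣m*n (sgn k) (∣m⇒∣m*n (bin n k ^ 2) ∣-refl)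

  η-weight-lucas : LucasTerm η-weight
  η-weight-lucas = below⇒term η-weight-supported (lower sgn-lucas ⊛ bin-below ⊛^ 3)

  s18-weight-supported : Supported s18-weight
  s18-weight-supported n k = ∣m⇒∣m*n _ (∣m⇒∣m*n _ (∣n⇒∣m*n (sgn k) ∣-refl))

  s18-weight-lucas : LucasTerm s18-weight
  s18-weight-lucas = below⇒term s18-weight-supported (lower sgn-lucas ⊛ bin-below ⊛ lower central-lucas ⊛ difference central-lucas)

-- The fifteen sequences

open import Defs

module Sequences (p : ℕ) (p-prime : Prime p) where
  open Modular p p-prime

  bin∣bin^ : ∀ n k m → bin n k ∣ bin n k ^ suc m
  bin∣bin^ n k m = ∣m⇒∣m*n (bin n k ^ m) ∣-refl

  bin∣bin^* : ∀ n k m x → bin n k ∣ bin n k ^ suc m * x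
  bin∣bin^* n k m x = ∣m⇒∣m*n x (bin∣bin^ n k m)

  a-lucas : LucasSeq (Cseq a)
  a-lucas = sum-below (λ n k → bin∣bin^ n k 2) (bin-below ⊛^ 3)

  b-lucas : LucasSeq (Cseq b)
  b-lucas = sum-below (λ n k → bin∣bin^* n k 1 _) (bin-below ⊛^ 2 ⊛ bin[n+k,n])

  c-lucas : LucasSeq (Cseq c)
  c-lucas = sum-below (λ n k → bin∣bin^* n k 1 _) (bin-below ⊛^ 2 ⊛ lower central-lucas)

  d-lucas : LucasSeq (Cseq d)
  d-lucas = sum-below (λ n k → ∣m⇒∣m*n _ (∣m⇒∣m*n _ ∣-refl)) (bin-below ⊛ lower central-lucas ⊛ difference central-lucas)

  α-lucas : LucasSeq (Cseq α)
  α-lucas = sum-below (λ n k → ∣m⇒∣m*n _ (bin∣bin^* n k 1 _)) (bin-below ⊛^ 2 ⊛ lower central-lucas ⊛ difference central-lucas)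

  ε-lucas : LucasSeq (Cseq ε)
  ε-lucas = sum-below (λ n k → bin∣bin^* n k 1 _) (bin-below ⊛^ 2 ⊛ bin[2k,n] ⊛^ 2)

  γ-lucas : LucasSeq (Cseq γ)
  γ-lucas = sum-below (λ n k → bin∣bin^* n k 1 _) (bin-below ⊛^ 2 ⊛ bin[n+k,n] ⊛^ 2)

  s7-lucas : LucasSeq (Cseq s7)
  s7-lucas = sum-below (λ n k → ∣m⇒∣m*n _ (bin∣bin^* n k 1 _)) (bin-below ⊛^ 2 ⊛ bin[n+k,k] ⊛ bin[2k,n])

  s10-lucas : LucasSeq (Cseq s10)
  s10-lucas = sum-below (λ n k → bin∣bin^ n k 3) (bin-below ⊛^ 4)

  -- The inner sum over l is the sequence (a) at `k`, so its congruence enters as one more factor.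
  g-lucas : LucasSeq (Cseq g)
  g-lucas = LucasSeq-resp
    (λ n → sumTo-cong n (λ k _ → sumTo-*ˡ k (sgn k * + (8 ℕ.^ (n ∸ k)) * bin n k) (λ l → bin k l ^ 3)))
    (sum-below (λ n k → ∣m⇒∣m*n (Cseq a k) (∣n⇒∣m*n (sgn k * + (8 ℕ.^ (n ∸ k))) ∣-refl))
               (lower sgn-lucas ⊛ difference (power-lucas 8) ⊛ bin-below ⊛ lower a-lucas))

  ζ-lucas : LucasSeq (Cseq ζ)
  ζ-lucas = LucasSeq-resp
    (λ n → sumTo-cong n (λ k _ → trans (sumTo-cong n (λ l _ → lem (bin n k ^ 2) (bin n l) (bin k l) (bin (k ℕ.+ l) n))) (sumTo-*ˡ n (bin n k ^ 2) _)))
    (sum-below (λ n k → bin∣bin^* n k 1 (ζ-inner n k)) (bin-below ⊛^ 2 ⊛ ζ-inner-below))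
    where
    lem : ∀ u x y z → u * x * y * z ≡ u * (x * y * z)
    lem = solve-∀

  f-term-supported : Supported f-term
  f-term-supported n k = ∣m⇒∣m*n _ ∣-refl

  f-lucas : LucasSeq (Cseq f)
  f-lucas = LucasSeq-resp
    (λ n → sumTo-/3 n (λ k 3k≤n → trans (lem (sgn k) (+ (3 ℕ.^ (n ∸ 3 ℕ.* k))) (bin n (3 ℕ.* k)) (+ multi3 k)) (cong (sgn k *_) (f-term≡ {n} {k} 3k≤n)))
                      (λ k n<3k → trans (cong (sgn k *_) (f-term-zero {n} {k} n<3k)) (ℤ.*-zeroʳ (sgn k))))
    (sum-below (λ n k → ∣n⇒∣m*n (sgn k) (f-term-supported n k)) (lower sgn-lucas ⊛ term⇒below f-term-lucas))
    where
    lem : ∀ s x y z → s * x * y * z ≡ s * (x * (y * z))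
    lem = solve-∀

  δ-lucas : LucasSeq (Cseq δ)
  δ-lucas = LucasSeq-resp
    (λ n → sumTo-/3 n (λ k 3k≤n → trans (lem (sgn k) (+ (3 ℕ.^ (n ∸ 3 ℕ.* k))) (bin n (3 ℕ.* k)) (bin (n ℕ.+ k) n) (+ multi3 k)) (cong (λ x → sgn k * bin (n ℕ.+ k) n * x) (f-term≡ {n} {k} 3k≤n)))
                      (λ k n<3k → trans (cong (λ x → sgn k * bin (n ℕ.+ k) n * x) (f-term-zero {n} {k} n<3k)) (ℤ.*-zeroʳ (sgn k * bin (n ℕ.+ k) n))))
    (sum-below (λ n k → ∣n⇒∣m*n (sgn k * bin (n ℕ.+ k) n) (f-term-supported n k)) (lower sgn-lucas ⊛ bin[n+k,n] ⊛ term⇒below f-term-lucas))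
    where
    lem : ∀ s x y w z → s * x * y * w * z ≡ s * w * (x * (y * z))
    lem = solve-∀

  η-lucas : LucasSeq (Cseq η)
  η-lucas = twisted-lucas η-weight-reflect η-weight-supported η-weight-lucas {3} ℕ.≤-refl sgn-3* η-sum

  s18-lucas : LucasSeq (Cseq s18)
  s18-lucas = LucasSeq-resp (λ n → sumTo-cong n (λ k _ → cong (λ m → s18-weight n k * binomℤ (+ (2 ℕ.* n) - + (3 ℕ.* k)) m) (sym (ℕ.*-identityˡ n))))
    (twisted-lucas s18-weight-reflect s18-weight-supported s18-weight-lucas {1} (s≤s z≤n) (λ n → cong sgn (ℕ.*-identityˡ n))
      -- For c = 1 a carry of 2 would mean n₀ = r + 2p, which contradicts n₀ < p; no error term
      -- arises.
      (λ {n₀} {r} n₀<p _ n₀≡ → contradiction n₀<p (ℕ.≤⇒≯ (ℕ.≤-trans (ℕ.m≤m*n p 2) (subst (p ℕ.* 2 ≤_) (trans (sym n₀≡) (ℕ.*-identityˡ n₀)) (ℕ.m≤n+m (p ℕ.* 2) r))))))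

  Cseq-lucas : ∀ s → LucasSeq (Cseq s)
  Cseq-lucas a   = a-lucas
  Cseq-lucas b   = b-lucas
  Cseq-lucas c   = c-lucas
  Cseq-lucas d   = d-lucas
  Cseq-lucas f   = f-lucas
  Cseq-lucas g   = g-lucas
  Cseq-lucas δ   = δ-lucas
  Cseq-lucas η   = η-lucas
  Cseq-lucas α   = α-lucas
  Cseq-lucas ε   = ε-lucas
  Cseq-lucas ζ   = ζ-lucas
  Cseq-lucas γ   = γ-lucas
  Cseq-lucas s7  = s7-lucas
  Cseq-lucas s10 = s10-lucas
  Cseq-lucas s18 = s18-lucas

  -- Starts the induction on digits: the empty list denotes 0, and the empty product is 1.
  Cseq-0 : ∀ s → Cseq s 0 ≡ 1ℤ
  Cseq-0 a   = refl
  Cseq-0 b   = refl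
  Cseq-0 c   = refl
  Cseq-0 d   = refl
  Cseq-0 f   = refl
  Cseq-0 g   = refl
  Cseq-0 δ   = refl
  Cseq-0 η   = refl
  Cseq-0 α   = refl
  Cseq-0 ε   = refl
  Cseq-0 ζ   = refl
  Cseq-0 γ   = refl
  Cseq-0 s7  = refl
  Cseq-0 s10 = refl
  Cseq-0 s18 = refl

  Cseq-digits : ∀ s {ds} → All (_< p) ds → Cseq s (fromDigits p ds) ≈ prodC s ds
  Cseq-digits s []                          = ≈-reflexive (Cseq-0 s)
  Cseq-digits s (_∷_ {x} {xs} x<p xs<p) = ≈-trans (at-digits (Cseq-lucas s) x<p (fromDigits p xs))
                                                  (*-cong (≈-refl {Cseq s x}) (Cseq-digits s xs<p))

theorem3p1 : (s : Seq) (p : ℕ) → Prime p → (ds : List ℕ) → All (_< p) ds →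
    (+ p) Unsigned.∣ (Cseq s (fromDigits p ds) - prodC s ds)
theorem3p1 s p p-prime ds ds<p = ∣⇒∣ᵤ (Modular._≈_.p∣x-y (Sequences.Cseq-digits p p-prime s ds<p))
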